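{- Let $\Delta \ge 3$ be a fixed integer. If $T$ is an open twin-free tree of order $n \ge 5$ that satisfies $\Delta(T) \le \Delta$, then \[ \gamma^{\mathrm{IOC}}(T) \le \left( \frac{2\Delta - 1}{2\Delta} \right) n, \] except in one exceptional case when $T = T_{\Delta}$, in which case $\gamma^{\mathrm{IOC}}(T) = \left( \frac{2\Delta}{2\Delta+1} \right) n$.
   Context: For a graph $G$, a set $S\subseteq V(G)$ is an identifying open code (IO-code) if every vertex has a neighbor in $S$ and $N_G(u)\cap S \ne N_G(v)\cap S$ for all distinct vertices $u,v$, where $N_G(v)$ is the open neighborhood. A graph is open twin-free if no two distinct vertices have the same open neighborhood; for isolate-free open twin-free $G$, $\gamma^{\mathrm{IOC}}(G)$ is the minimum cardinality of an IO-code. The subdivided star $T_\Delta$ is the tree obtained from the star $K_{1,\Delta}$ by subdividing every edge exactly once. -}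

module Defs where

open import Data.Nat using (ℕ; zero; suc; _+_; _*_; _∸_; _≤_; _<ᵇ_; _≡ᵇ_)
open import Data.Bool using (Bool; true; false; _∧_; _∨_; if_then_else_; T)
open import Data.Fin using (Fin; toℕ)
open import Data.Fin.Subset using (Subset; _∈_; ∣_∣)
open import Data.Product using (Σ; _×_; _,_; ∃)
open import Relation.Binary.PropositionalEquality using (_≡_; _≢_)
open import Relation.Nullary using (¬_)
open import Function.Bundles using (_↔_; Inverse)

sumFin : (n : ℕ) → (Fin n → ℕ) → ℕ
sumFin zero f = 0
sumFin (suc n) f = f Fin.zero + sumFin n (λ i → f (Fin.suc i))

record Graph (n : ℕ) : Set where
  field
    adj   : Fin n → Fin n → Bool
    sym   : ∀ u v → adj u v ≡ adj v u
    irrefl : ∀ v → adj v v ≡ false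
open Graph public

Adj : ∀ {n} → Graph n → Fin n → Fin n → Set
Adj G u v = T (adj G u v)

b2n : Bool → ℕ
b2n true = 1
b2n false = 0

deg : ∀ {n} → Graph n → Fin n → ℕ
deg {n} G v = sumFin n (λ w → b2n (adj G v w))

MaxDegLe : ∀ {n} → Graph n → ℕ → Set
MaxDegLe G D = ∀ v → deg G v ≤ D

edgeCount : ∀ {n} → Graph n → ℕ
edgeCount {n} G = sumFin n (λ i → sumFin n (λ j →
  b2n ((toℕ i <ᵇ toℕ j) ∧ adj G i j)))

data Reach {n} (G : Graph n) : Fin n → Fin n → Set where
  here : ∀ {u} → Reach G u u
  step : ∀ {u v w} → Adj G u v → Reach G v w → Reach G u w

Connected : ∀ {n} → Graph n → Set
Connected G = ∀ u v → Reach G u v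

IsTree : ∀ {n} → Graph n → Set
IsTree {n} G = Connected G × edgeCount G ≡ n ∸ 1

OpenTwinFree : ∀ {n} → Graph n → Set
OpenTwinFree {n} G = ∀ u v → u ≢ v →
  ¬ (∀ w → (Adj G u w → Adj G v w) × (Adj G v w → Adj G u w))

IsIOCode : ∀ {n} → Graph n → Subset n → Set
IsIOCode {n} G S =
  (∀ v → ∃ λ u → u ∈ S × Adj G v u) ×
  (∀ u v → u ≢ v →
     ¬ (∀ w → w ∈ S → (Adj G u w → Adj G v w) × (Adj G v w → Adj G u w)))

IsGammaIOC : ∀ {n} → Graph n → ℕ → Set
IsGammaIOC G k =
  (∃ λ S → IsIOCode G S × ∣ S ∣ ≡ k) × (∀ S → IsIOCode G S → k ≤ ∣ S ∣)

-- subdivided star T_D on Fin (1 + D + D):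
-- vertex 0 = centre, vertices 1..D = subdivision vertices,
-- vertex D + i is the leaf attached to vertex i (1 ≤ i ≤ D)
inMid : ℕ → ℕ → Bool
inMid D a = (0 <ᵇ a) ∧ ((a <ᵇ D) ∨ (a ≡ᵇ D))

edgeTS : ℕ → ℕ → ℕ → Bool
edgeTS D a b =
  ((a ≡ᵇ 0) ∧ inMid D b) ∨ ((b ≡ᵇ 0) ∧ inMid D a) ∨
  (inMid D a ∧ (b ≡ᵇ (a + D))) ∨ (inMid D b ∧ (a ≡ᵇ (b + D)))

-- "T is the subdivided star T_D": isomorphic to the graph on Fin (1 + D + D)
-- with adjacency edgeTS D (stated via adjacency function to avoid proof fields)
IsSubdividedStar : ∀ {n} → Graph n → ℕ → Set
IsSubdividedStar {n} G D = Σ (Fin n ↔ Fin (1 + D + D)) λ f →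
  ∀ u v → adj G u v ≡ edgeTS D (toℕ (Inverse.to f u)) (toℕ (Inverse.to f v))

{-# OPTIONS --safe #-}
module Submission where

-- A code is the complement of a set of deleted vertices such that no N(v) is deleted entirely and
-- every surviving w has at most one neighbour v that is private to w, i.e. whose only surviving
-- neighbour is w (in a tree two vertices have at most one common neighbour, so two equal traces
-- N(u) ∩ S = N(v) ∩ S are a single vertex w).  These conditions couple a vertex only with vertices
-- at even distance, so the two bipartition classes are independent.  Root the tree at a leaf.  For
-- each branch t one records how many vertices can be deleted when its root is seen as an element of
-- the code (count a) and how many when its root is seen as a vertex to be dominated (count c), in a
-- few boundary states.  Comparing |t| with 2Δ(a + c), every branch other than K₁ and P₂ falls into
-- one of eight profiles whose discrepancy is at most 2, and this is preserved when branches are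
-- joined under a new root.  Only P₄ and T_Δ escape the resulting bound at the root of the tree.
open import Defs
open import Data.Bool using (Bool; true; false; not; T; _∧_)
open import Data.Bool.Properties as Bool using (T-∧; T-∨)
open import Data.Empty using (⊥; ⊥-elim)
open import Data.Fin as Fin using (Fin; toℕ; _↑ˡ_; _↑ʳ_; splitAt; join; punchOut)
open import Data.Fin.Permutation using (↔⇒≡)
open import Data.Fin.Properties as Fin using (toℕ-injective)
open import Data.Fin.Subset using (∣_∣)
open import Data.Fin.Subset using (Subset; ⁅_⁆; ∁) renaming (_∈_ to _∈ₛ_)
open import Data.Fin.Subset.Properties as Subset using () renaming (_∈?_ to _∈ₛ?_)
open import Data.List using (List; []; _∷_; _++_; length; map; allFin; tabulate; cartesianProduct)
open import Data.List.Membership.Propositional using (_∈_; _∉_)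
open import Data.List.Membership.Propositional.Properties
  using (∈-++⁺ˡ; ∈-++⁺ʳ; ∈-++⁻; ∈-map⁺; ∈-map⁻; ∈-∃++; ∈-allFin; ∈-cartesianProduct⁺)
import Data.List.Membership.DecPropositional as DecMembership
open import Data.List.Properties using (map-++; map-∘; map-cong; length-++; length-map; length-tabulate; ++-identityʳ)
open import Data.List.Relation.Binary.Permutation.Propositional
  using (_↭_; ↭-refl; ↭-sym; ↭-trans; ↭-reflexive; prep; swap)
open import Data.List.Relation.Binary.Permutation.Propositional.Properties
  using (↭-length; ↭-singleton-inv; All-resp-↭; ∈-resp-↭; map⁺; shift; shifts; ++⁺ˡ; ++⁺ʳ)
  renaming (++⁺ to ++⁺-↭; ++-assoc to ++-assoc-↭)
open import Data.List.Relation.Unary.All as All using (All; []; _∷_)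
open import Data.List.Relation.Unary.All.Properties using (++⁺; ++⁻ˡ; ++⁻ʳ)
open import Data.List.Relation.Unary.AllPairs using ([]; _∷_)
open import Data.List.Relation.Unary.Any using (here; there)
open import Data.List.Relation.Unary.Unique.Propositional using (Unique)
open import Data.List.Relation.Unary.Unique.Propositional.Properties using (allFin⁺)
open import Data.Nat using (ℕ; _+_; _*_; _∸_; _≤_)
open import Data.Nat using (zero; suc; _<_; _≟_; z≤n; s≤s; _<ᵇ_; _≡ᵇ_)
open import Data.Nat.ListAction using (sum)
open import Data.Nat.ListAction.Properties using (sum-++; sum-↭)
open import Data.Nat.Properties as ℕ
  using (≤-trans; ≤-refl; ≤-reflexive; +-mono-≤; +-suc; +-comm; +-identityʳ; *-monoʳ-≤; +-cancelʳ-≤;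
         m≤m+n; m≤n+m; n≤1+n; ≤∧≢⇒<)
open import Data.Nat.Tactic.RingSolver using (solve-∀)
open import Data.Product using (_×_; ∃)
open import Data.Product using (_,_; ∃₂; ∃-syntax; proj₁; proj₂)
open import Data.Product.Properties using (≡-dec)
open import Data.Sum as Sum using (_⊎_; inj₁; inj₂)
open import Data.Unit using (⊤; tt)
open import Data.Vec as Vec using ()
open import Data.Vec.Properties using (lookup∘tabulate; lookup⇒[]=; []=⇒lookup)
open import Function using (_∘_; id; Equivalence)
open import Function.Bundles using (Inverse; mk↔ₛ′)
open import Relation.Binary.PropositionalEquality using (_≡_)
open import Relation.Binary.PropositionalEquality using (_≢_; refl; trans; cong; cong₂; subst) renaming (sym to ≡-sym)
open import Relation.Nullary using (¬_)
open import Relation.Nullary using (Dec; yes; no; contradiction; ¬?)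
open import Relation.Nullary.Decidable using (does; dec-true; dec-false; decidable-stable)

-- A join adds one new vertex and adds up the debts of the branches below it. Each debt is at most 2
-- and a vertex with a parent carries at most Δ - 1 branches, so the total is at most 2Δ - 1; one
-- extra deleted vertex, worth 2Δ, covers it. This is the origin of the constant. A profile in debt
-- therefore also records an option, a state in which one more vertex can be deleted: either the
-- root of the branch itself (`R`), or some vertex at the price of leaving the root private to its
-- parent (`Z`). The parent cashes such options and takes the plain counts elsewhere. K₁ and P₂
-- stand apart because a leaf has no child to keep: as a vertex to be dominated it is always private
-- to its parent, so the root of P₂ must survive and own its leaf, and the states `N` and `R` are
-- closed to it. Rooting at a leaf makes every join take place below a parent, and leaves the
-- hanging of a single branch as the last step.

data Tree (V : Set) : Set where
  node : V → List (Tree V) → Tree V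

size  : ∀ {V} → Tree V → ℕ
sizeF : ∀ {V} → List (Tree V) → ℕ
size (node v ts) = suc (sizeF ts)
sizeF []         = 0
sizeF (t ∷ ts)   = size t + sizeF ts

-- The root of a branch as a possible element of the code: R deleted; N surviving with no private
-- child; I surviving with at most one private child; X either R or I.
data ElemState : Set where
  R N I X : ElemState

-- The root of a branch as a vertex to be dominated and separated: F its parent is absent or deleted;
-- K its parent survives and some child survives; Z its parent survives and all children are deleted,
-- so that it is private to its parent.
data ConsState : Set where
  F K Z : ConsState

-- Boundary states of a branch and the deletions they allow

module _ {V : Set} where

  data E  : ElemState → Tree V → ℕ → Set
  data C  : ConsState → Tree V → ℕ → Set
  data EF : ElemState → List (Tree V) → ℕ → Set
  data CF : ConsState → List (Tree V) → ℕ → Set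

  -- E s t k and C s t k: in state s at least k vertices of t can be deleted, at even distance from
  -- the root for E and at odd distance for C.
  data E where
    removed : ∀ {v ts us k l} → ts ↭ us → CF F us l → k ≤ suc l → E R (node v ts) k
    kept    : ∀ {v ts us k l} → ts ↭ us → CF K us l → k ≤ l → E N (node v ts) k
    owned   : ∀ {v ts u us k j l} → ts ↭ u ∷ us → C Z u j → CF K us l → k ≤ j + l → E I (node v ts) k
    N⇒I     : ∀ {t k} → E N t k → E I t k
    R⇒X     : ∀ {t k} → E R t k → E X t k
    I⇒X     : ∀ {t k} → E I t k → E X t k

  data C where
    none : ∀ {v ts us k l} → ts ↭ us → EF R us l → k ≤ l → C Z (node v ts) k
    some : ∀ {v ts u us k j l} → ts ↭ u ∷ us → E I u j → EF X us l → k ≤ j + l → C K (node v ts) k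
    one  : ∀ {v ts u us k j l} → ts ↭ u ∷ us → E N u j → EF X us l → k ≤ j + l → C F (node v ts) k
    two  : ∀ {v ts u u′ us k i j l} → ts ↭ u ∷ u′ ∷ us → E I u i → E I u′ j → EF X us l →
           k ≤ i + (j + l) → C F (node v ts) k

  data EF where
    []  : ∀ {s} → EF s [] 0
    _∷_ : ∀ {s t ts j l} → E s t j → EF s ts l → EF s (t ∷ ts) (j + l)

  data CF where
    []  : ∀ {s} → CF s [] 0
    _∷_ : ∀ {s t ts j l} → C s t j → CF s ts l → CF s (t ∷ ts) (j + l)

  -- Both ways of reaching `F` keep a child. If the parent survives too, the root has two surviving
  -- neighbours and is private to none, so the demands of `one` and `two` only get weaker.
  F⇒K : ∀ {t k} → C F t k → C K t k
  F⇒K (one p e es h)     = some p (N⇒I e) es h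
  F⇒K (two p e e′ es h) = some p e (I⇒X e′ ∷ es) h

  mapEF : ∀ {s s′ ts k} → (∀ {t j} → E s t j → E s′ t j) → EF s ts k → EF s′ ts k
  mapEF f []       = []
  mapEF f (e ∷ es) = f e ∷ mapEF f es

  mapCF : ∀ {s s′ ts k} → (∀ {t j} → C s t j → C s′ t j) → CF s ts k → CF s′ ts k
  mapCF f []       = []
  mapCF f (c ∷ cs) = f c ∷ mapCF f cs

sizeF-↭ : ∀ {V} {ts us : List (Tree V)} → ts ↭ us → sizeF ts ≡ sizeF us
sizeF-↭ _↭_.refl = refl
sizeF-↭ (prep t p) = cong (size t +_) (sizeF-↭ p)
sizeF-↭ (swap {xs} {ys} t u p) rewrite sizeF-↭ p = lemma (size t) (size u) (sizeF ys)
  where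
  lemma : ∀ a b c → a + (b + c) ≡ b + (a + c)
  lemma = solve-∀
sizeF-↭ (_↭_.trans p q) = trans (sizeF-↭ p) (sizeF-↭ q)

-- Children are unordered, so a distinguished child is brought to the front by a permutation; the
-- constructors of `E` and `C` carry a `↭` to absorb it.
find : ∀ {A : Set} {P Q : A → Set} {xs} → All (λ x → P x ⊎ Q x) xs →
       All P xs ⊎ ∃₂ λ y ys → xs ↭ y ∷ ys × Q y × All (λ x → P x ⊎ Q x) ys
find [] = inj₁ []
find (inj₂ q ∷ ds) = inj₂ (_ , _ , ↭-refl , q , ds)
find {xs = x ∷ _} (inj₁ p ∷ ds) with find ds
... | inj₁ ps = inj₁ (p ∷ ps)
... | inj₂ (y , ys , π , q , ds′) = inj₂ (y , x ∷ ys , ↭-trans (prep x π) (swap x y ↭-refl) , q , inj₁ p ∷ ds′)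

-- Every linear inequality below is certified by exhibiting the slack k, which leaves a semiring identity.
linear : ∀ {l r x y} k → l ≤ r → x + r + k ≡ y + l → x ≤ y
linear {l} {r} {x} {y} k l≤r eq = ≤-trans (m≤m+n x k)
  (+-cancelʳ-≤ r (x + k) y (≤-trans (≤-reflexive (trans (lemma x k r) eq)) (+-mono-≤ (≤-refl {y}) l≤r)))
  where
  lemma : ∀ x k r → x + k + r ≡ x + r + k
  lemma = solve-∀

-- Profiles of branches and their debts

module _ {V : Set} where

  IsLeaf : Tree V → Set
  IsLeaf t = ∃[ v ] t ≡ node v []

  IsPath₂ : Tree V → Set
  IsPath₂ t = ∃₂ λ v u → t ≡ node v (node u [] ∷ [])

  Support : Tree V → Set
  Support (node v ts) = ∃₂ λ u us → ts ↭ node u [] ∷ us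

  IsPath₃ : Tree V → Set
  IsPath₃ t = ∃₂ λ v u → t ≡ node v (u ∷ []) × IsPath₂ u

-- `W` is the worth of one deleted vertex, later `2 * D`. The bound `2 * D ≤ W` pays for debts of 2
-- in all branches at a vertex; `6 ≤ W`, which comes from `3 ≤ D`, absorbs the constant costs, as at
-- a vertex with a single child.
module Bound {V : Set} (D W : ℕ) (2D≤W : 2 * D ≤ W) (6≤W : 6 ≤ W) where

  -- The `suc` counts the edge to the parent, since a branch always hangs from some vertex. Two leaf
  -- children would be open twins.
  data Good : Tree V → Set where
    good : ∀ {v ts} → suc (length ts) ≤ D → (∀ {a b us} → ¬ (ts ↭ node a [] ∷ node b [] ∷ us)) →
           All Good ts → Good (node v ts)

  -- T_Δ with one leg cut off, rooted at its centre: together with the parent the centre has full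
  -- degree `D`.
  IsStar : Tree V → Set
  IsStar (node v ts) = All IsPath₂ ts × suc (length ts) ≡ D

  IsHungStar : Tree V → Set
  IsHungStar t = ∃₂ λ v u → t ≡ node v (u ∷ []) × IsStar u

  -- Hanging a branch below a new vertex sends X → Q → V → S → T → B → U → O → B.
  data Profile (t : Tree V) : Set where
    pX : ∀ {a c} → E I t a → C K t c → 2 + size t ≤ W * (a + c) → Profile t
    pQ : ∀ {a c} → E N t a → C K t c → 1 + size t ≤ W * (a + c) → Profile t
    pV : ∀ {a c} → E N t a → C F t c → size t ≤ W * (a + c) → Profile t
    pS : ∀ {a c} → E R t (suc a) → E N t a → C F t c → size t ≤ W * (a + c) + 1 → Profile t
    pT : ∀ {a c} → E R t (suc a) → E N t a → C K t c → C Z t (suc c) → size t ≤ W * (a + c) + 2 → Profile t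
    pB : ∀ {a c} → E I t a → C F t c → 1 + size t ≤ W * (a + c) →
         2 + size t ≤ W * (a + c) ⊎ IsStar t → Profile t
    pU : ∀ {a c} → E R t (suc a) → E N t a → C K t c → size t ≤ W * (a + c) → Profile t
    pO : ∀ {a c} → E N t a → C K t c → C Z t (suc c) → size t ≤ W * (a + c) + 1 → Profile t

  -- The whole tree is `t` hung from the leaf `r`. The count `c` belongs to the class of `r`, and
  -- `e` to the other class, where `r` is dominated by the root of `t`. The inequality says that
  -- each deleted vertex pays for `W` vertices.
  Rootable : Tree V → Set
  Rootable t = ∀ r → ∃₂ λ e c → E N t e × E X (node r (t ∷ [])) c × suc (size t) ≤ W * (e + c)

  -- Hung from a leaf, these branches give respectively K₂, a tree in which that leaf has an open
  -- twin, P₄, and T_Δ.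
  Exceptional : Tree V → Set
  Exceptional t = IsLeaf t ⊎ Support t ⊎ IsPath₃ t ⊎ IsHungStar t

  -- A coarsening of the profiles, sufficient when at least two branches are joined: deleting the root
  -- gains a vertex in β, making it private to its parent gains one in ω.
  data β (t : Tree V) : Set where
    mkβ : ∀ {a c} → E R t (suc a) → E N t a → C K t c → size t ≤ W * (a + c) + 2 → β t
  data ω (t : Tree V) : Set where
    mkω : ∀ {a c} → E N t a → C K t c → C Z t (suc c) → size t ≤ W * (a + c) + 1 → ω t
  data ν (t : Tree V) : Set where
    mkν : ∀ {a c} → E N t a → C F t c → size t ≤ W * (a + c) → ν t
  data κ (t : Tree V) : Set where
    mkκ : ∀ {a c} → E I t a → C K t c → 1 + size t ≤ W * (a + c) → κ t

  Class : Tree V → Set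
  Class t = (((ν t ⊎ κ t) ⊎ ω t) ⊎ β t)

  classify : ∀ {t} → Profile t → Class t
  classify (pX e c h) = inj₁ (inj₁ (inj₂ (mkκ e c (≤-trans (m≤n+m _ 1) h))))
  classify (pQ e c h) = inj₁ (inj₁ (inj₂ (mkκ (N⇒I e) c h)))
  classify (pV e c h) = inj₁ (inj₁ (inj₁ (mkν e c h)))
  classify (pS r e c h) = inj₂ (mkβ r e (F⇒K c) (≤-trans h (+-mono-≤ ≤-refl (s≤s z≤n))))
  classify (pT r e c z h) = inj₂ (mkβ r e c h)
  classify (pB e c h _) = inj₁ (inj₁ (inj₂ (mkκ e (F⇒K c) h)))
  classify (pU r e c h) = inj₂ (mkβ r e c (≤-trans h (m≤m+n _ 2)))
  classify (pO e c z h) = inj₁ (inj₂ (mkω e c z h))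

  -- The common denominator of all branches but K₁: the states `I` and `K` are available with a debt
  -- `σ`, which is 0 for `ν` and `κ`, 1 for `ω`, and 2 for `β` and P₂.
  Base : ℕ → Tree V → Set
  Base σ t = ∃₂ λ a c → E I t a × C K t c × size t ≤ W * (a + c) + σ

  BaseF : ℕ → List (Tree V) → Set
  BaseF σ ts = ∃₂ λ a c → EF I ts a × CF K ts c × sizeF ts ≤ W * (a + c) + length ts * σ

  baseF : ∀ {σ ts} → All (Base σ) ts → BaseF σ ts
  baseF [] = 0 , 0 , [] , [] , z≤n
  baseF {σ} {t ∷ ts} ((a , c , e , d , h) ∷ bs) with baseF bs
  ... | a′ , c′ , es , ds , h′ = _ , _ , e ∷ es , d ∷ ds , linear 0 (+-mono-≤ h h′) (lemma (size t) (sizeF ts) W a c a′ c′ σ (length ts))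
    where
    lemma : ∀ s s′ W a c a′ c′ σ m → s + s′ + (W * (a + c) + σ + (W * (a′ + c′) + m * σ)) + 0 ≡
            W * (a + a′ + (c + c′)) + (σ + m * σ) + (s + s′)
    lemma = solve-∀

  νκ⇒Base : ∀ {t} → ν t ⊎ κ t → Base 0 t
  νκ⇒Base (inj₁ (mkν e c h)) = _ , _ , N⇒I e , F⇒K c , ≤-trans h (m≤m+n _ 0)
  νκ⇒Base (inj₂ (mkκ e c h)) = _ , _ , e , c , ≤-trans (m≤n+m _ 1) (≤-trans h (m≤m+n _ 0))

  weaken : ∀ {σ τ t} → σ ≤ τ → Base σ t → Base τ t
  weaken σ≤τ (a , c , e , d , h) = a , c , e , d , ≤-trans h (+-mono-≤ ≤-refl σ≤τ)

  νκω⇒Base : ∀ {t} → (ν t ⊎ κ t) ⊎ ω t → Base 1 t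
  νκω⇒Base (inj₁ d) = weaken z≤n (νκ⇒Base d)
  νκω⇒Base (inj₂ (mkω e c _ h)) = _ , _ , N⇒I e , c , h

  Class⇒Base : ∀ {t} → Class t → Base 2 t
  Class⇒Base (inj₁ d) = weaken (s≤s z≤n) (νκω⇒Base d)
  Class⇒Base (inj₂ (mkβ _ e c h)) = _ , _ , N⇒I e , c , h

  leafR : ∀ {v} → E {V} R (node v []) 1
  leafR = removed ↭-refl [] ≤-refl
  leafZ : ∀ {v} → C {V} Z (node v []) 0
  leafZ = none ↭-refl [] ≤-refl
  -- The leaf is dominated by the root alone, so the root owns it and cannot be in state `N`.
  path₂I : ∀ {t : Tree V} → IsPath₂ t → E I t 0
  path₂I (v , u , refl) = owned ↭-refl leafZ [] z≤n
  path₂K : ∀ {t : Tree V} → IsPath₂ t → C K t 0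
  path₂K (v , u , refl) = some ↭-refl (N⇒I (kept ↭-refl [] z≤n)) [] z≤n
  path₂Z : ∀ {t : Tree V} → IsPath₂ t → C Z t 1
  path₂Z (v , u , refl) = none ↭-refl (leafR ∷ []) ≤-refl
  path₂-size : ∀ {t : Tree V} → IsPath₂ t → size t ≡ 2
  path₂-size (v , u , refl) = refl

  path₂⇒Base : ∀ {t} → IsPath₂ t → Base 2 t
  path₂⇒Base p = 0 , 0 , path₂I p , path₂K p , ≤-trans (≤-reflexive (path₂-size p)) (m≤n+m 2 _)

  -- The three treatments of the leaf `r`: it survives with no private child, it is deleted, or it
  -- survives with the root of `t` private to it. Deleting it gains a vertex but requires the root
  -- of `t` to be dominated from below without help.
  rootK : ∀ {t e c} → E N t e → C K t c → suc (size t) ≤ W * (e + c) → Rootable t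
  rootK e d h r = _ , _ , e , I⇒X (N⇒I (kept ↭-refl (d ∷ []) (m≤m+n _ 0))) , h

  rootF : ∀ {t e c} → E N t e → C F t c → suc (size t) ≤ W * (e + suc c) → Rootable t
  rootF e d h r = _ , _ , e , R⇒X (removed ↭-refl (d ∷ []) (s≤s (m≤m+n _ 0))) , h

  rootZ : ∀ {t e c} → E N t e → C Z t c → suc (size t) ≤ W * (e + c) → Rootable t
  rootZ e d h r = _ , _ , e , I⇒X (owned ↭-refl d [] (m≤m+n _ 0)) , h

  -- One deleted vertex covers a debt of 2 for every branch below a vertex and still leaves 2.
  width : ∀ {ts us : List (Tree V)} → suc (length ts) ≤ D → ts ↭ us → 2 * suc (length us) ≤ W
  width {ts} l p rewrite ≡-sym (↭-length p) = ≤-trans (*-monoʳ-≤ 2 l) 2D≤W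

  -- Joining branches under a new vertex

  Result : Tree V → Set
  Result t = Profile t × (Exceptional t ⊎ Rootable t)

  -- The leaf child depends on the root, which survives and owns it. The vertex gained is the leaf
  -- itself, deleted in its own class, while `u` survives there to provide state `K`.
  supportNode : ∀ {v ts b u us} → suc (length ts) ≤ D → ts ↭ node b [] ∷ u ∷ us →
                Base 2 u → All (Base 2) us → Profile (node v ts)
  supportNode {v} {ts} {b} {u} {us} l p (a , c , e , d , h) bs with baseF bs
  ... | a′ , c′ , es , ds , h′ =
    pX (owned p leafZ (d ∷ ds) ≤-refl)
       (some (↭-trans p (swap _ _ ↭-refl)) e (R⇒X leafR ∷ mapEF I⇒X es) ≤-refl)
       (linear 0 (+-mono-≤ (≤-reflexive (sizeF-↭ p)) (+-mono-≤ h (+-mono-≤ h′ (width l p))))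
         (arith (sizeF ts) (size u) (sizeF us) W a c a′ c′ (length us)))
    where
    arith : ∀ S s s′ W a c a′ c′ m →
      3 + S + (1 + (s + s′) + (W * (a + c) + 2 + (W * (a′ + c′) + m * 2 + W))) + 0 ≡
      W * (0 + (c + c′) + (a + (1 + a′))) + (S + (s + (s′ + 2 * suc (2 + m))))
    arith = solve-∀

  module PathNode {v : V} {ts : List (Tree V)} {p u : Tree V} {us : List (Tree V)} {σ : ℕ} (π : ts ↭ p ∷ u ∷ us) (path : IsPath₂ p)
                  (bu : Base σ u) (bus : BaseF 2 us) where
    a  = proj₁ bu
    c  = proj₁ (proj₂ bu)
    a′ = proj₁ bus
    c′ = proj₁ (proj₂ bus)
    eu : E I u a
    eu = proj₁ (proj₂ (proj₂ bu))
    du : C K u c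
    du = proj₁ (proj₂ (proj₂ (proj₂ bu)))
    es : EF I us a′
    es = proj₁ (proj₂ (proj₂ bus))
    ds : CF K us c′
    ds = proj₁ (proj₂ (proj₂ (proj₂ bus)))

    -- The leaf of the P₂ child is deleted, which makes the root of that child private to `v`: this
    -- is the vertex gained.
    inI : E I (node v ts) (1 + (c + c′))
    inI = owned π (path₂Z path) (du ∷ ds) ≤-refl

    inN : E N (node v ts) (c + c′)
    inN = kept π (path₂K path ∷ du ∷ ds) ≤-refl

    inF : C F (node v ts) (a + a′)
    inF = two π (path₂I path) eu (mapEF I⇒X es) ≤-refl

    -- Here `ρ` is the surplus wanted, `σ` the debt of `u`, and `τ` the number of child places that
    -- the degree bound leaves free. After the debts of `us`, the worth `W` of the gained vertex
    -- leaves `6 + 2 * τ`, of which 3 pay for `v` and the P₂; the rest must cover `ρ + σ`.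
    bound : ∀ τ ρ k → 2 * (τ + suc (2 + length us)) ≤ W → ρ + σ + k ≡ 3 + 2 * τ →
            ρ + size (node v ts) ≤ W * (1 + (c + c′) + (a + a′))
    bound τ ρ k hW eq = linear k
      (+-mono-≤ (≤-reflexive (sizeF-↭ π)) (+-mono-≤ (≤-reflexive (path₂-size path))
        (+-mono-≤ (proj₂ (proj₂ (proj₂ (proj₂ bu)))) (+-mono-≤ (proj₂ (proj₂ (proj₂ (proj₂ bus)))) hW))))
      (trans (arith₁ (sizeF ts) (size p) (size u) (sizeF us) W a c a′ c′ (length us) σ τ ρ k)
        (trans (cong (_+ (suc (sizeF ts) + (size p + (size u + sizeF us) + (2 + (W * (a + c) + (W * (a′ + c′) + length us * 2 + W)))))) eq) (arith₂ (sizeF ts) (size p) (size u) (sizeF us) W a c a′ c′ (length us) τ)))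
      where
      arith₁ : ∀ S q s s′ W a c a′ c′ m σ τ ρ k →
        ρ + suc S + (q + (s + s′) + (2 + (W * (a + c) + σ + (W * (a′ + c′) + m * 2 + W)))) + k ≡
        (ρ + σ + k) + (suc S + (q + (s + s′) + (2 + (W * (a + c) + (W * (a′ + c′) + m * 2 + W)))))
      arith₁ = solve-∀
      arith₂ : ∀ S q s s′ W a c a′ c′ m τ →
        (3 + 2 * τ) + (suc S + (q + (s + s′) + (2 + (W * (a + c) + (W * (a′ + c′) + m * 2 + W))))) ≡
        W * (1 + (c + c′) + (a + a′)) + (S + (q + (s + (s′ + 2 * (τ + suc (2 + m))))))
      arith₂ = solve-∀

    shift-suc : W * (1 + (c + c′) + (a + a′)) ≡ W * (c + c′ + suc (a + a′))
    shift-suc = cong (W *_) (arith (c + c′) (a + a′))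
      where
      arith : ∀ x y → 1 + x + y ≡ x + suc y
      arith = solve-∀

    root : 1 + size (node v ts) ≤ W * (1 + (c + c′) + (a + a′)) → Rootable (node v ts)
    root h = rootF inN inF (≤-trans h (≤-reflexive shift-suc))

  starNode : ∀ {v ts p us} → suc (length ts) ≤ D → ts ↭ p ∷ us → IsPath₂ p → All IsPath₂ us →
             Result (node v ts)
  starNode {v} {ts} {p} {[]} l π path [] =
    pX (owned π (path₂Z path) [] ≤-refl) (some π (path₂I path) [] ≤-refl)
       (≤-trans (≤-reflexive size≡) (≤-trans (n≤1+n 5) (≤-trans 6≤W (≤-reflexive (lemma W))))) ,
    inj₁ (inj₂ (inj₂ (inj₁ (v , p , cong (node v) (↭-singleton-inv π) , path))))
    where
    lemma : ∀ w → w ≡ w * 1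
    lemma = solve-∀
    size≡ : 3 + sizeF ts ≡ 5
    size≡ rewrite sizeF-↭ π | path₂-size path = refl
  starNode {v} {ts} {p} {u ∷ us} l π path (pu ∷ ps) = pB inI inF weak exact , inj₂ (root weak)
    where
    open PathNode {v} π path (path₂⇒Base pu) (baseF (All.map path₂⇒Base ps))
    weak : 1 + size (node v ts) ≤ W * (1 + (c + c′) + (a + a′))
    weak = bound 0 1 0 (width l π) refl
    exact : 2 + size (node v ts) ≤ W * (1 + (c + c′) + (a + a′)) ⊎ IsStar (node v ts)
    -- All branches have debt 2, so a surplus of 2 requires a free child place; without one the
    -- branch is T_Δ minus a leg.
    exact with suc (length ts) ≟ D
    ... | yes eq = inj₂ (All-resp-↭ (↭-sym π) (path ∷ pu ∷ ps) , eq)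
    ... | no neq = inj₁ (bound 1 2 1 (subst (λ m → 2 * suc (suc m) ≤ W) (↭-length π)
            (≤-trans (*-monoʳ-≤ 2 (≤∧≢⇒< l neq)) 2D≤W)) refl)

  pathNode : ∀ {v ts p us} → suc (length ts) ≤ D → ts ↭ p ∷ us → IsPath₂ p →
             All (λ t → IsPath₂ t ⊎ Class t) us → Result (node v ts)
  pathNode l π path ds with find ds
  ... | inj₁ ps = starNode l π path ps
  pathNode {v} {ts} {p} l π path ds | inj₂ (u , us , π′ , inj₁ d , ds′) =
    pB inI inF weak (inj₁ (bound 0 2 0 (width l ρ) refl)) , inj₂ (root weak)
    where
    ρ = ↭-trans π (prep p π′)
    open PathNode {v} ρ path (νκω⇒Base d) (baseF (All.map Sum.[ path₂⇒Base , Class⇒Base ] ds′))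
    weak : 1 + size (node v ts) ≤ W * (1 + (c + c′) + (a + a′))
    weak = bound 0 1 1 (width l ρ) refl
  -- A debt of 2 in `u` leaves only surplus 1. But the P₂ root can be the surviving child, so the
  -- root of `u` may be deleted, and this second gain lifts the result to profile X.
  pathNode {v} {ts} {p} l π path ds | inj₂ (u , us , π′ , inj₂ (mkβ {a₁} {c₁} r e d h) , ds′) =
    pX inI (some ρ (path₂I path) (R⇒X r ∷ mapEF I⇒X es) ≤-refl)
      (linear 5 (+-mono-≤ weak 6≤W) (arith (size (node v ts)) W a₁ c₁ a′ c′)) ,
    inj₂ (root weak)
    where
    ρ = ↭-trans π (prep p π′)
    open PathNode {v} ρ path (_ , _ , N⇒I e , d , h) (baseF (All.map Sum.[ path₂⇒Base , Class⇒Base ] ds′))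
    weak : 1 + size (node v ts) ≤ W * (1 + (c + c′) + (a + a′))
    weak = bound 0 1 0 (width l ρ) refl
    arith : ∀ S W a c a′ c′ → 2 + S + (W * (1 + (c + c′) + (a + a′)) + W) + 5 ≡
            W * (1 + (c + c′) + (suc a + a′)) + (1 + S + 6)
    arith = solve-∀

  -- Shared by T and O. Making the root of `t` private to `v` gains a vertex worth at least 6,
  -- enough for the debt 2, the new vertex, and the surplus 2 of the stronger form of B.
  privateNode : ∀ {v t a c} → E N t a → C K t c → C Z t (suc c) → size t ≤ W * (a + c) + 2 → Result (node v (t ∷ []))
  privateNode {v} {t} {a} {c} e d z h =
    pB (owned ↭-refl z [] (s≤s (m≤m+n _ 0))) e₁ (≤-trans (n≤1+n _) bnd) (inj₁ bnd) ,
    inj₂ (rootF (kept ↭-refl (d ∷ []) (m≤m+n _ 0)) e₁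
      (≤-trans (n≤1+n _) (≤-trans bnd (≤-reflexive (arith′ W c a)))))
    where
    e₁ = one {v = v} ↭-refl e [] (m≤m+n _ 0)
    bnd : 3 + (size t + 0) ≤ W * (suc c + a)
    bnd = linear 1 (+-mono-≤ h 6≤W) (arith (size t) W a c)
      where
      arith : ∀ s W a c → 3 + (s + 0) + (W * (a + c) + 2 + W) + 1 ≡ W * (suc c + a) + (s + 6)
      arith = solve-∀
    arith′ : ∀ W c a → W * (suc c + a) ≡ W * (c + suc a)
    arith′ = solve-∀

  -- Under a new vertex the two counts exchange roles: `K` below gives `N` above, `F` gives `R`, `I`
  -- gives `K`, `N` gives `F` and `R` gives `Z`. Every step without a gain costs one, so surplus
  -- turns into debt until the private option of T or O is cashed.
  chainNode : ∀ {v t} → Profile t → Result (node v (t ∷ []))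
  chainNode {v} {t} q with q
  ... | pX {a} {c} e d h = pQ d₁ e₁ bnd , inj₂ (rootK d₁ e₁ bnd)
    where
    d₁ = kept {v = v} ↭-refl (d ∷ []) (m≤m+n _ 0)
    e₁ = some {v = v} ↭-refl e [] (m≤m+n _ 0)
    bnd : 2 + (size t + 0) ≤ W * (c + a)
    bnd = linear 0 h (arith (size t) W a c)
      where
      arith : ∀ s W a c → 2 + (s + 0) + W * (a + c) + 0 ≡ W * (c + a) + (2 + s)
      arith = solve-∀
  ... | pQ {a} {c} e d h = pV d₁ e₁ bnd ,
        inj₂ (rootF d₁ e₁ (linear 5 (+-mono-≤ bnd 6≤W) (arith′ (size (node v (t ∷ []))) W c a)))
    where
    d₁ = kept {v = v} ↭-refl (d ∷ []) (m≤m+n _ 0)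
    e₁ = one {v = v} ↭-refl e [] (m≤m+n _ 0)
    bnd : 1 + (size t + 0) ≤ W * (c + a)
    bnd = linear 0 h (arith (size t) W a c)
      where
      arith : ∀ s W a c → 1 + (s + 0) + W * (a + c) + 0 ≡ W * (c + a) + (1 + s)
      arith = solve-∀
    arith′ : ∀ s W c a → suc s + (W * (c + a) + W) + 5 ≡ W * (c + suc a) + (s + 6)
    arith′ = solve-∀
  ... | pV {a} {c} e d h = pS (removed ↭-refl (d ∷ []) (s≤s (m≤m+n _ 0))) d₁ e₁ bnd ,
        inj₂ (rootF d₁ e₁ (linear 4 (+-mono-≤ bnd 6≤W) (arith′ (size (node v (t ∷ []))) W c a)))
    where
    d₁ = kept {v = v} ↭-refl (F⇒K d ∷ []) (m≤m+n _ 0)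
    e₁ = one {v = v} ↭-refl e [] (m≤m+n _ 0)
    bnd : 1 + (size t + 0) ≤ W * (c + a) + 1
    bnd = linear 0 h (arith (size t) W a c)
      where
      arith : ∀ s W a c → 1 + (s + 0) + W * (a + c) + 0 ≡ W * (c + a) + 1 + s
      arith = solve-∀
    arith′ : ∀ s W c a → suc s + (W * (c + a) + 1 + W) + 4 ≡ W * (c + suc a) + (s + 6)
    arith′ = solve-∀
  ... | pS {a} {c} r e d h =
        pT (removed ↭-refl (d ∷ []) (s≤s (m≤m+n _ 0))) d₁ (some ↭-refl (N⇒I e) [] (m≤m+n _ 0)) z₁ bnd ,
        inj₂ (rootZ d₁ z₁ (linear 3 (+-mono-≤ bnd 6≤W) (arith′ (size (node v (t ∷ []))) W c a)))
    where
    d₁ = kept {v = v} ↭-refl (F⇒K d ∷ []) (m≤m+n _ 0)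
    z₁ = none {v = v} ↭-refl (r ∷ []) (s≤s (m≤m+n _ 0))
    bnd : 1 + (size t + 0) ≤ W * (c + a) + 2
    bnd = linear 0 h (arith (size t) W a c)
      where
      arith : ∀ s W a c → 1 + (s + 0) + (W * (a + c) + 1) + 0 ≡ W * (c + a) + 2 + s
      arith = solve-∀
    arith′ : ∀ s W c a → suc s + (W * (c + a) + 2 + W) + 3 ≡ W * (c + suc a) + (s + 6)
    arith′ = solve-∀
  ... | pT r e d z h = privateNode e d z h
  ... | pB {a} {c} e d h h⁺ =
        pU (removed ↭-refl (d ∷ []) (s≤s (m≤m+n _ 0))) d₁ e₁ (bnd h) , root h⁺
    where
    d₁ = kept {v = v} ↭-refl (F⇒K d ∷ []) (m≤m+n _ 0)
    e₁ = some {v = v} ↭-refl e [] (m≤m+n _ 0)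
    bnd : ∀ {k} → k + size t ≤ W * (a + c) → k + (size t + 0) ≤ W * (c + a)
    bnd {k} h = linear 0 h (arith k (size t) W a c)
      where
      arith : ∀ k s W a c → k + (s + 0) + W * (a + c) + 0 ≡ W * (c + a) + (k + s)
      arith = solve-∀
    -- Between `t` and the whole tree lie two more vertices, `v` and the leaf above it, so surplus 2
    -- is required. If only the weak form of B holds, `t` is a full star and these two vertices are
    -- its missing leg.
    root : 2 + size t ≤ W * (a + c) ⊎ IsStar t → Exceptional (node v (t ∷ [])) ⊎ Rootable (node v (t ∷ []))
    root (inj₁ h) = inj₂ (rootK d₁ e₁ (bnd h))
    root (inj₂ s) = inj₁ (inj₂ (inj₂ (inj₂ (v , t , refl , s))))
  ... | pU {a} {c} r e d h =
        pO d₁ (some ↭-refl (N⇒I e) [] (m≤m+n _ 0)) z₁ bnd ,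
        inj₂ (rootZ d₁ z₁ (linear 4 (+-mono-≤ bnd 6≤W) (arith′ (size (node v (t ∷ []))) W c a)))
    where
    d₁ = kept {v = v} ↭-refl (d ∷ []) (m≤m+n _ 0)
    z₁ = none {v = v} ↭-refl (r ∷ []) (s≤s (m≤m+n _ 0))
    bnd : 1 + (size t + 0) ≤ W * (c + a) + 1
    bnd = linear 0 h (arith (size t) W a c)
      where
      arith : ∀ s W a c → 1 + (s + 0) + W * (a + c) + 0 ≡ W * (c + a) + 1 + s
      arith = solve-∀
    arith′ : ∀ s W c a → suc s + (W * (c + a) + 1 + W) + 4 ≡ W * (c + suc a) + (s + 6)
    arith′ = solve-∀
  ... | pO e d z h = privateNode e d z (≤-trans h (+-mono-≤ ≤-refl (s≤s z≤n)))

  νF : ∀ {ts} → All ν ts → ∃₂ λ a c → EF N ts a × CF F ts c × sizeF ts ≤ W * (a + c)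
  νF [] = 0 , 0 , [] , [] , z≤n
  νF {t ∷ ts} (mkν {a} {c} e d h ∷ ds) with νF ds
  ... | a′ , c′ , es , fs , h′ = _ , _ , e ∷ es , d ∷ fs , linear 0 (+-mono-≤ h h′) (arith (size t) (sizeF ts) W a c a′ c′)
    where
    arith : ∀ s s′ W a c a′ c′ → s + s′ + (W * (a + c) + W * (a′ + c′)) + 0 ≡
            W * (a + a′ + (c + c′)) + (s + s′)
    arith = solve-∀

  βF : ∀ {ts} → All β ts → ∃₂ λ r c → EF R ts r × CF K ts c ×
       sizeF ts + length ts * W ≤ W * (r + c) + length ts * 2
  βF [] = 0 , 0 , [] , [] , z≤n
  βF {t ∷ ts} (mkβ {a} {c} r e d h ∷ ds) with βF ds
  ... | r′ , c′ , rs , fs , h′ = _ , _ , r ∷ rs , d ∷ fs ,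
        linear 0 (+-mono-≤ h h′) (arith (size t) (sizeF ts) W a c r′ c′ (length ts))
    where
    arith : ∀ s s′ W a c r c′ m →
      s + s′ + (W + m * W) + (W * (a + c) + 2 + (W * (r + c′) + m * 2)) + 0 ≡
      W * (suc a + r + (c + c′)) + (2 + m * 2) + (s + (s′ + m * W))
    arith = solve-∀

  -- Seen as a vertex to be dominated, `v` needs just one surviving child: `t` survives and the
  -- roots of all other branches are deleted. One of these gains already pays all debts; the others
  -- are slack.
  allβNode : ∀ {v ts t u us} → suc (length ts) ≤ D → ts ↭ t ∷ u ∷ us → β t → All β (u ∷ us) → Result (node v ts)
  allβNode {v} {ts} {t} {u} {us} l π (mkβ {a} {c} _ e d h) ds with βF ds
  ... | r , c′ , rs , fs , h′ = pV inN inF (≤-trans (n≤1+n _) bnd) ,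
        inj₂ (rootF inN inF (≤-trans bnd (≤-trans (m≤m+n _ W) (≤-reflexive (arith′ W (c + c′) (a + r))))))
    where
    inN = kept {v = v} π (d ∷ fs) ≤-refl
    inF = one {v = v} π e (mapEF R⇒X rs) ≤-refl
    bnd : 1 + size (node v ts) ≤ W * (c + c′ + (a + r))
    bnd = linear (length us * W)
      (+-mono-≤ (≤-reflexive (sizeF-↭ π)) (+-mono-≤ h (+-mono-≤ h′ (width l π))))
      (arith (sizeF ts) (size t) (sizeF (u ∷ us)) W a c r c′ (length us))
      where
      arith : ∀ S s s′ W a c r c′ m →
        2 + S + (s + s′ + (W * (a + c) + 2 + (W * (r + c′) + suc m * 2 + W))) + m * W ≡
        W * (c + c′ + (a + r)) + (S + (s + (s′ + suc m * W + 2 * suc (2 + m))))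
      arith = solve-∀
    arith′ : ∀ W x y → W * (x + y) + W ≡ W * (x + suc y)
    arith′ = solve-∀

  -- With `u` surviving, the root of `t` can be deleted. The budget is exact: 1 for `v`, 2 for the
  -- surplus, and debts 2, 1 and `2 * length us` exhaust `2 * suc (2 + length us)`. Hence `u` must
  -- have debt at most 1.
  mixedNode : ∀ {v ts t u us} → suc (length ts) ≤ D → ts ↭ t ∷ u ∷ us → β t → Base 1 u → All (Base 2) us →
              Result (node v ts)
  mixedNode {v} {ts} {t} {u} {us} l π (mkβ {a} {c} r _ d h) (a₁ , c₁ , e₁ , d₁ , h₁) bs with baseF bs
  ... | a′ , c′ , es , ds , h′ = pX (N⇒I inN) inK bnd , inj₂ (rootK inN inK (≤-trans (n≤1+n _) bnd))
    where
    inN = kept {v = v} π (d ∷ d₁ ∷ ds) ≤-refl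
    inK = some {v = v} (↭-trans π (swap _ _ ↭-refl)) e₁ (R⇒X r ∷ mapEF I⇒X es) ≤-refl
    bnd : 2 + size (node v ts) ≤ W * (c + (c₁ + c′) + (a₁ + (suc a + a′)))
    bnd = linear 0
      (+-mono-≤ (≤-reflexive (sizeF-↭ π)) (+-mono-≤ h (+-mono-≤ h₁ (+-mono-≤ h′ (width l π)))))
      (arith (sizeF ts) (size t) (size u) (sizeF us) W a c a₁ c₁ a′ c′ (length us))
      where
      arith : ∀ S s s₁ s′ W a c a₁ c₁ a′ c′ m →
        3 + S + (s + (s₁ + s′) + (W * (a + c) + 2 + (W * (a₁ + c₁) + 1 + (W * (a′ + c′) + m * 2 + W)))) + 0 ≡
        W * (c + (c₁ + c′) + (a₁ + (suc a + a′))) + (S + (s + (s₁ + (s′ + 2 * suc (2 + m)))))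
      arith = solve-∀

  -- The gain comes from making the root of `t` private to `v`, which allows only one branch to be
  -- cashed; debts of at most 1 elsewhere leave room.
  ωNode : ∀ {v ts t u us} → suc (length ts) ≤ D → ts ↭ t ∷ u ∷ us → ω t → All (Base 1) (u ∷ us) → Result (node v ts)
  ωNode {v} {ts} {t} {u} {us} l π (mkω {a} {c} e d z h) (b ∷ bs) with baseF (b ∷ bs)
  ... | _ , c′ , eu ∷ es , ds , h′ = pX (owned π z ds ≤-refl) (F⇒K inF) bnd , inj₂ (rootF inN inF
          (≤-trans (n≤1+n _) (≤-trans bnd (≤-reflexive (arith′ W (c + c′) _)))))
    where
    inN = kept {v = v} π (d ∷ ds) ≤-refl
    inF = two {v = v} π (N⇒I e) eu (mapEF I⇒X es) ≤-refl
    bnd : 2 + size (node v ts) ≤ W * (suc c + c′ + (a + _))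
    bnd = linear (suc (length us))
      (+-mono-≤ (≤-reflexive (sizeF-↭ π)) (+-mono-≤ h (+-mono-≤ h′ (width l π))))
      (arith (sizeF ts) (size t) (sizeF (u ∷ us)) W a c _ c′ (length us))
      where
      arith : ∀ S s s′ W a c a′ c′ m →
        3 + S + (s + s′ + (W * (a + c) + 1 + (W * (a′ + c′) + suc m * 1 + W))) + suc m ≡
        W * (suc c + c′ + (a + a′)) + (S + (s + (s′ + 2 * suc (2 + m))))
      arith = solve-∀
    arith′ : ∀ W x y → W * (suc x + y) ≡ W * (x + suc y)
    arith′ = solve-∀

  -- Nothing is gained here: the surplus of `t` pays for the new vertex, and the other branches are
  -- free of debt.
  κNode : ∀ {v ts t u us} → ts ↭ t ∷ u ∷ us → κ t → All (Base 0) (u ∷ us) → Result (node v ts)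
  κNode {v} {ts} {t} {u} {us} π (mkκ {a} {c} e d h) (b ∷ bs) with baseF (b ∷ bs)
  ... | _ , c′ , eu ∷ es , ds , h′ = pV inN inF bnd , inj₂ (rootF inN inF (linear 5 (+-mono-≤ bnd 6≤W)
          (arith′ (size (node v ts)) W (c + c′) _)))
    where
    inN = kept {v = v} π (d ∷ ds) ≤-refl
    inF = two {v = v} π e eu (mapEF I⇒X es) ≤-refl
    bnd : size (node v ts) ≤ W * (c + c′ + (a + _))
    bnd = linear 0
      (+-mono-≤ (≤-reflexive (sizeF-↭ π)) (+-mono-≤ h h′))
      (arith (sizeF ts) (size t) (sizeF (u ∷ us)) W a c _ c′ (length us))
      where
      arith : ∀ S s s′ W a c a′ c′ m →
        1 + S + (s + s′ + (W * (a + c) + (W * (a′ + c′) + suc m * 0))) + 0 ≡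
        W * (c + c′ + (a + a′)) + (S + (1 + s + s′))
      arith = solve-∀
    arith′ : ∀ s W x y → suc s + (W * (x + y) + W) + 5 ≡ W * (x + suc y) + (s + 6)
    arith′ = solve-∀

  -- The new vertex becomes a debt of 1, and the compensating option is to delete it, which is
  -- possible because every child is in state `F`.
  allνNode : ∀ {v t u us} → All ν (t ∷ u ∷ us) → Result (node v (t ∷ u ∷ us))
  allνNode {v} {t} {u} {us} ds with νF ds
  ... | _ , c , e ∷ e′ ∷ es , fs , h =
        pS (removed ↭-refl fs ≤-refl) inN inF (linear 0 h (arith S W _ c)) ,
        inj₂ (rootF inN inF (linear 4 (+-mono-≤ h 6≤W) (arith′ S W _ c)))
    where
    S = sizeF (t ∷ u ∷ us)
    inN = kept {v = v} ↭-refl (mapCF F⇒K fs) ≤-refl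
    inF = two {v = v} ↭-refl (N⇒I e) (N⇒I e′) (mapEF (λ e → I⇒X (N⇒I e)) es) ≤-refl
    arith : ∀ S W a c → 1 + S + W * (a + c) + 0 ≡ W * (c + a) + 1 + S
    arith = solve-∀
    arith′ : ∀ S W a c → 2 + S + (W * (a + c) + W) + 4 ≡ W * (c + suc a) + (S + 6)
    arith′ = solve-∀

  branchNode : ∀ {v t u us} → suc (length (t ∷ u ∷ us)) ≤ D → All Class (t ∷ u ∷ us) →
               Result (node v (t ∷ u ∷ us))
  branchNode l ds with find ds
  branchNode l ds | inj₁ ds₁ with find ds₁
  branchNode l ds | inj₁ ds₁ | inj₁ ds₂ with find ds₂
  ... | inj₁ ds₃ = allνNode ds₃
  ... | inj₂ (y , [] , π , _) = contradiction (↭-length π) λ ()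
  ... | inj₂ (y , _ ∷ _ , π , q , ds₃) = κNode π q (All.map νκ⇒Base ds₃)
  branchNode l ds | inj₁ ds₁ | inj₂ (y , [] , π , _) = contradiction (↭-length π) λ ()
  branchNode l ds | inj₁ ds₁ | inj₂ (y , _ ∷ _ , π , q , ds₂) = ωNode l π q (All.map νκω⇒Base ds₂)
  branchNode l ds | inj₂ (y , ys , π , q , ds₁) with find (All.map Sum.swap ds₁)
  branchNode l ds | inj₂ (y , [] , π , q , ds₁) | inj₁ ds₂ = contradiction (↭-length π) λ ()
  branchNode l ds | inj₂ (y , _ ∷ _ , π , q , ds₁) | inj₁ ds₂ = allβNode l π q ds₂
  branchNode l ds | inj₂ (y , ys , π , q , ds₁) | inj₂ (z , zs , π′ , p , ds₂) =
    mixedNode l (↭-trans π (prep y π′)) q (νκω⇒Base p) (All.map (λ d → Class⇒Base (Sum.swap d)) ds₂)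

  Shape : Tree V → Set
  Shape t = (Class t × Profile t ⊎ IsPath₂ t) ⊎ IsLeaf t

  shape⇒Base : ∀ {t} → Class t × Profile t ⊎ IsPath₂ t → Base 2 t
  shape⇒Base (inj₁ (d , _)) = Class⇒Base d
  shape⇒Base (inj₂ p) = path₂⇒Base p

  nonLeaves : ∀ {v b : V} {ts us : List (Tree V)} → Good (node v ts) → ts ↭ node b [] ∷ us →
              All Shape us → All (λ t → Class t × Profile t ⊎ IsPath₂ t) us
  nonLeaves (good _ twins _) π ds with find ds
  ... | inj₁ ds′ = ds′
  ... | inj₂ (_ , us , π′ , (_ , refl) , _) = ⊥-elim (twins (↭-trans π (prep _ π′)))

  result  : ∀ {t} → Good t → Shape t × (Exceptional t ⊎ Rootable t)
  shapes  : ∀ {ts} → All Good ts → All Shape ts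

  shapes []       = []
  shapes (g ∷ gs) = proj₁ (result g) ∷ shapes gs

  private
    done : ∀ {t} → Result t → Shape t × (Exceptional t ⊎ Rootable t)
    done (q , x) = inj₁ (inj₁ (classify q , q)) , x

  result {node v ts} g@(good l _ gs) with find (shapes gs)
  ... | inj₂ (_ , us , π , (b , refl) , ds) with nonLeaves g π ds
  ...   | [] = inj₁ (inj₂ (v , b , cong (node v) (↭-singleton-inv π))) , inj₁ (inj₂ (inj₁ (b , [] , π)))
  ...   | d ∷ ds′ = inj₁ (inj₁ (classify q , q)) , inj₁ (inj₂ (inj₁ (b , _ , π)))
    where q = supportNode l π (shape⇒Base d) (All.map shape⇒Base ds′)
  result {node v ts} g@(good l _ gs) | inj₁ ds with find ds
  ... | inj₂ (p , us , π , path , ds′) =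
        done (pathNode l π path (All.map Sum.[ (λ d → inj₂ (proj₁ d)) , inj₁ ] ds′))
  ... | inj₁ [] = inj₂ (v , refl) , inj₁ (inj₁ (v , refl))
  ... | inj₁ (d ∷ []) = done (chainNode (proj₂ d))
  ... | inj₁ (d ∷ d′ ∷ ds′) = done (branchNode l (All.map proj₁ (d ∷ d′ ∷ ds′)))

-- Vertex assignments read off from derivations, and rooted neighbourhoods

Unique-↭ : ∀ {A : Set} {xs ys : List A} → xs ↭ ys → Unique xs → Unique ys
Unique-↭ _↭_.refl u = u
Unique-↭ (prep x p) (x∉ ∷ u) = All-resp-↭ p x∉ ∷ Unique-↭ p u
Unique-↭ (swap x y p) ((x≢y ∷ x∉) ∷ y∉ ∷ u) =
  ((λ y≡x → x≢y (≡-sym y≡x)) ∷ All-resp-↭ p y∉) ∷ All-resp-↭ p x∉ ∷ Unique-↭ p u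
Unique-↭ (_↭_.trans p q) u = Unique-↭ q (Unique-↭ p u)

module _ {V : Set} where

  root : Tree V → V
  root (node v _) = v

  verts  : Tree V → List V
  vertsF : List (Tree V) → List V
  verts (node v ts) = v ∷ vertsF ts
  vertsF []         = []
  vertsF (t ∷ ts)   = verts t ++ vertsF ts

  evens  : Tree V → List V
  odds   : Tree V → List V
  evensF : List (Tree V) → List V
  oddsF  : List (Tree V) → List V
  evens (node v ts) = v ∷ oddsF ts
  odds (node v ts)  = evensF ts
  evensF []         = []
  evensF (t ∷ ts)   = evens t ++ evensF ts
  oddsF []          = []
  oddsF (t ∷ ts)    = odds t ++ oddsF ts

  evensF-↭ : ∀ {ts us} → ts ↭ us → evensF ts ↭ evensF us
  evensF-↭ _↭_.refl = ↭-refl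
  evensF-↭ (prep t p) = ++⁺ˡ (evens t) (evensF-↭ p)
  evensF-↭ (swap t u p) = ↭-trans (shifts (evens t) (evens u)) (++⁺ˡ (evens u) (++⁺ˡ (evens t) (evensF-↭ p)))
  evensF-↭ (_↭_.trans p q) = ↭-trans (evensF-↭ p) (evensF-↭ q)

  oddsF-↭ : ∀ {ts us} → ts ↭ us → oddsF ts ↭ oddsF us
  oddsF-↭ _↭_.refl = ↭-refl
  oddsF-↭ (prep t p) = ++⁺ˡ (odds t) (oddsF-↭ p)
  oddsF-↭ (swap t u p) = ↭-trans (shifts (odds t) (odds u)) (++⁺ˡ (odds u) (++⁺ˡ (odds t) (oddsF-↭ p)))
  oddsF-↭ (_↭_.trans p q) = ↭-trans (oddsF-↭ p) (oddsF-↭ q)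

  evens-odds  : ∀ t → evens t ++ odds t ↭ verts t
  evensF-oddsF : ∀ ts → oddsF ts ++ evensF ts ↭ vertsF ts
  evens-odds (node v ts) = prep v (evensF-oddsF ts)
  evensF-oddsF [] = ↭-refl
  evensF-oddsF (t ∷ ts) =
    ↭-trans (++-assoc-↭ (odds t) (oddsF ts) _)
    (↭-trans (++⁺ˡ (odds t) (shifts (oddsF ts) (evens t)))
    (↭-trans (shifts (odds t) (evens t))
    (↭-trans (↭-sym (++-assoc-↭ (evens t) (odds t) _))
      (++⁺-↭ (evens-odds t) (evensF-oddsF ts)))))

  -- The mark `true` means deleted. A derivation of `E` lists each vertex at even distance from the
  -- root once, one of `C` each vertex at odd distance.
  Assignment : Set
  Assignment = List (V × Bool)

  asgE  : ∀ {s} {t : Tree V} {k} → E s t k → Assignment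
  asgC  : ∀ {s} {t : Tree V} {k} → C s t k → Assignment
  asgEF : ∀ {s} {ts : List (Tree V)} {k} → EF s ts k → Assignment
  asgCF : ∀ {s} {ts : List (Tree V)} {k} → CF s ts k → Assignment
  asgE (removed {v = v} _ cs _) = (v , true) ∷ asgCF cs
  asgE (kept {v = v} _ cs _)    = (v , false) ∷ asgCF cs
  asgE (owned {v = v} _ c cs _) = (v , false) ∷ asgC c ++ asgCF cs
  asgE (N⇒I e) = asgE e
  asgE (R⇒X e) = asgE e
  asgE (I⇒X e) = asgE e
  asgC (none _ es _)      = asgEF es
  asgC (some _ e es _)    = asgE e ++ asgEF es
  asgC (one _ e es _)     = asgE e ++ asgEF es
  asgC (two _ e e′ es _)  = asgE e ++ asgE e′ ++ asgEF es
  asgEF []       = []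
  asgEF (e ∷ es) = asgE e ++ asgEF es
  asgCF []       = []
  asgCF (c ∷ cs) = asgC c ++ asgCF cs

  keys : Assignment → List V
  keys = map proj₁

  private
    keys-++ : ∀ (xs ys : Assignment) {as bs} → keys xs ↭ as → keys ys ↭ bs → keys (xs ++ ys) ↭ as ++ bs
    keys-++ xs ys p q = ↭-trans (↭-reflexive (map-++ proj₁ xs ys)) (++⁺-↭ p q)

  keysE  : ∀ {s t k} (d : E s t k) → keys (asgE d) ↭ evens t
  keysC  : ∀ {s t k} (d : C s t k) → keys (asgC d) ↭ odds t
  keysEF : ∀ {s ts k} (d : EF s ts k) → keys (asgEF d) ↭ evensF ts
  keysCF : ∀ {s ts k} (d : CF s ts k) → keys (asgCF d) ↭ oddsF ts
  keysE (removed p cs _) = prep _ (↭-trans (keysCF cs) (oddsF-↭ (↭-sym p)))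
  keysE (kept p cs _)    = prep _ (↭-trans (keysCF cs) (oddsF-↭ (↭-sym p)))
  keysE (owned p c cs _) = prep _ (↭-trans (keys-++ (asgC c) _ (keysC c) (keysCF cs)) (oddsF-↭ (↭-sym p)))
  keysE (N⇒I e) = keysE e
  keysE (R⇒X e) = keysE e
  keysE (I⇒X e) = keysE e
  keysC (none p es _)     = ↭-trans (keysEF es) (evensF-↭ (↭-sym p))
  keysC (some p e es _)   = ↭-trans (keys-++ (asgE e) _ (keysE e) (keysEF es)) (evensF-↭ (↭-sym p))
  keysC (one p e es _)    = ↭-trans (keys-++ (asgE e) _ (keysE e) (keysEF es)) (evensF-↭ (↭-sym p))
  keysC (two p e e′ es _) = ↭-trans (keys-++ (asgE e) _ (keysE e) (keys-++ (asgE e′) _ (keysE e′) (keysEF es)))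
                                    (evensF-↭ (↭-sym p))
  keysEF []       = ↭-refl
  keysEF (e ∷ es) = keys-++ (asgE e) _ (keysE e) (keysEF es)
  keysCF []       = ↭-refl
  keysCF (c ∷ cs) = keys-++ (asgC c) _ (keysC c) (keysCF cs)

  #removed : Assignment → ℕ
  #removed as = sum (map (λ a → b2n (proj₂ a)) as)

  #removed-++ : ∀ xs ys → #removed (xs ++ ys) ≡ #removed xs + #removed ys
  #removed-++ xs ys = trans (cong sum (map-++ _ xs ys)) (sum-++ (map _ xs) (map _ ys))

  private
    add : ∀ xs ys {j l} → j ≤ #removed xs → l ≤ #removed ys → j + l ≤ #removed (xs ++ ys)
    add xs ys p q = ≤-trans (+-mono-≤ p q) (≤-reflexive (≡-sym (#removed-++ xs ys)))

  countE  : ∀ {s t k} (d : E s t k) → k ≤ #removed (asgE d)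
  countC  : ∀ {s t k} (d : C s t k) → k ≤ #removed (asgC d)
  countEF : ∀ {s ts k} (d : EF s ts k) → k ≤ #removed (asgEF d)
  countCF : ∀ {s ts k} (d : CF s ts k) → k ≤ #removed (asgCF d)
  countE (removed _ cs h) = ≤-trans h (s≤s (countCF cs))
  countE (kept _ cs h)    = ≤-trans h (countCF cs)
  countE (owned _ c cs h) = ≤-trans h (add (asgC c) _ (countC c) (countCF cs))
  countE (N⇒I e) = countE e
  countE (R⇒X e) = countE e
  countE (I⇒X e) = countE e
  countC (none _ es h)     = ≤-trans h (countEF es)
  countC (some _ e es h)   = ≤-trans h (add (asgE e) _ (countE e) (countEF es))
  countC (one _ e es h)    = ≤-trans h (add (asgE e) _ (countE e) (countEF es))
  countC (two _ e e′ es h) = ≤-trans h (add (asgE e) _ (countE e) (add (asgE e′) _ (countE e′) (countEF es)))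
  countEF []       = z≤n
  countEF (e ∷ es) = add (asgE e) _ (countE e) (countEF es)
  countCF []       = z≤n
  countCF (c ∷ cs) = add (asgC c) _ (countC c) (countCF cs)

  -- The list `ps` holds the parent, or is empty at the root of the whole tree. Only neighbourhoods
  -- are described; that distant vertices differ follows separately from `verts t` being a
  -- permutation of all vertices.
  data Rooted (_~_ : V → V → Set) (ps : List V) : Tree V → Set where
    rooted : ∀ {v ts} → length ps ≤ 1 → Unique (ps ++ map root ts) →
             (∀ {w} → v ~ w → w ∈ ps ++ map root ts) → (∀ {w} → w ∈ ps ++ map root ts → v ~ w) →
             All (Rooted _~_ (v ∷ [])) ts → Rooted _~_ ps (node v ts)

  permute : ∀ {_~_ ps v ts us} → ts ↭ us → Rooted _~_ ps (node v ts) → Rooted _~_ ps (node v us)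
  permute {ps = ps} p (rooted l u to from rs) =
    rooted l (Unique-↭ q u) (λ a → ∈-resp-↭ q (to a)) (λ m → from (∈-resp-↭ (↭-sym q) m)) (All-resp-↭ p rs)
    where q = ++⁺ˡ ps (map⁺ root p)

  Unique-++-≢ : ∀ {xs ys : List V} {x y} → Unique (xs ++ ys) → x ∈ xs → y ∈ ys → x ≢ y
  Unique-++-≢ {x ∷ xs} (x∉ ∷ u) (here refl) y∈ = All.lookup x∉ (∈-++⁺ʳ xs y∈)
  Unique-++-≢ {x ∷ xs} (x∉ ∷ u) (there m) y∈ = Unique-++-≢ u m y∈

  Unique-++ʳ : ∀ (xs : List V) {ys} → Unique (xs ++ ys) → Unique ys
  Unique-++ʳ [] u = u
  Unique-++ʳ (x ∷ xs) (_ ∷ u) = Unique-++ʳ xs u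

  Unique-++ˡ : ∀ {xs ys : List V} → Unique (xs ++ ys) → Unique xs
  Unique-++ˡ {[]} _ = []
  Unique-++ˡ {x ∷ xs} (x∉ ∷ u) = ++⁻ˡ xs x∉ ∷ Unique-++ˡ u

  head-≢ : ∀ {xs : List V} {x y} → Unique (x ∷ xs) → y ∈ xs → x ≢ y
  head-≢ (x∉ ∷ _) y∈ = All.lookup x∉ y∈

  unique-∈ : ∀ {xs : List V} {x y} → length xs ≤ 1 → x ∈ xs → y ∈ xs → x ≡ y
  unique-∈ {_ ∷ []} _ (here refl) (here refl) = refl
  unique-∈ {_ ∷ _ ∷ _} (s≤s ()) _ _

  -- Soundness: derivations yield domination and separation

  module Sound (_~_ : V → V → Set) (~-sym : ∀ {x y} → x ~ y → y ~ x) (ρ : V → Bool) where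

    Kept : V → V → Set
    Kept v w = v ~ w × ρ w ≡ false

    Private : V → V → Set
    Private v w = Kept v w × (∀ w′ → Kept v w′ → w′ ≡ w)

    Separated : V → Set
    Separated w = ∀ u v → Private u w → Private v w → u ≡ v

    Dominated : V → Set
    Dominated v = ∃ (Kept v)

    Agrees : Assignment → Set
    Agrees = All (λ a → ρ (proj₁ a) ≡ proj₂ a)

    keptI : ∀ {t : Tree V} {k} (d : E I t k) → Agrees (asgE d) → ρ (root t) ≡ false
    keptI (owned _ _ _ _) (h ∷ _) = h
    keptI (N⇒I (kept _ _ _)) (h ∷ _) = h

    removedR : ∀ {t : Tree V} {k} (d : E R t k) → Agrees (asgE d) → ρ (root t) ≡ true
    removedR (removed _ _ _) (h ∷ _) = h

    -- A surviving vertex tolerates one private neighbour. In state `N` no child takes this place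
    -- and the parent may have it; in the other states the parent must not be private to the root.
    PreE : ElemState → List V → Tree V → Set
    PreE N ps t = ⊤
    PreE _ ps t = ∀ {p} → p ∈ ps → ¬ Private p (root t)

    PreC : ConsState → List V → Set
    PreC F ps = ∀ {p} → p ∈ ps → ρ p ≡ true
    PreC _ ps = ∃[ p ] p ∈ ps × ρ p ≡ false

    -- Only `K` promises the parent anything: in `Z` the root is meant to be private to its parent,
    -- and in `F` there is no surviving parent.
    PostC : ConsState → List V → Tree V → Set
    PostC K ps t = ∀ {p} → p ∈ ps → ¬ Private (root t) p
    PostC _ ps t = ⊤

    true≢false : ∀ {b} → b ≡ true → b ≡ false → ⊥
    true≢false refl ()

    removedEF : ∀ {ts : List (Tree V)} {k v} (d : EF R ts k) → Agrees (asgEF d) → All (PreE R (v ∷ [])) ts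
    removedEF [] _ = []
    removedEF (e ∷ es) g =
      (λ { (here refl) ((_ , k) , _) → true≢false (removedR e (++⁻ˡ (asgE e) g)) k }) ∷ removedEF es (++⁻ʳ (asgE e) g)

    soundE  : ∀ {s} {t : Tree V} {k ps} (d : E s t k) → Rooted _~_ ps t → Agrees (asgE d) → PreE s ps t →
              All Separated (evens t) × All Dominated (odds t)
    soundC  : ∀ {s} {t : Tree V} {k ps} (d : C s t k) → Rooted _~_ ps t → Agrees (asgC d) → PreC s ps →
              (All Dominated (evens t) × All Separated (odds t)) × PostC s ps t
    soundEF : ∀ {s} {ts : List (Tree V)} {k v} (d : EF s ts k) → All (Rooted _~_ (v ∷ [])) ts → Agrees (asgEF d) →
              All (PreE s (v ∷ [])) ts → All Separated (evensF ts) × All Dominated (oddsF ts)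
    soundCF : ∀ {s} {ts : List (Tree V)} {k v} (d : CF s ts k) → All (Rooted _~_ (v ∷ [])) ts → Agrees (asgCF d) → PreC s (v ∷ []) →
              (All Dominated (evensF ts) × All Separated (oddsF ts)) × All (PostC s (v ∷ [])) ts

    soundEF [] [] _ [] = [] , []
    soundEF (e ∷ es) (r ∷ rs) g (q ∷ qs) with soundE e r (++⁻ˡ (asgE e) g) q | soundEF es rs (++⁻ʳ (asgE e) g) qs
    ... | a , b | as , bs = ++⁺ a as , ++⁺ b bs

    soundCF [] [] _ _ = ([] , []) , []
    soundCF (c ∷ cs) (r ∷ rs) g q with soundC c r (++⁻ˡ (asgC c) g) q | soundCF cs rs (++⁻ʳ (asgC c) g) q
    ... | (a , b) , z | (as , bs) , zs = (++⁺ a as , ++⁺ b bs) , z ∷ zs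

    soundE (removed p cs _) r (g ∷ gs) q with permute p r
    ... | rooted _ _ _ _ rs with soundCF cs rs gs (λ { (here refl) → g })
    ...   | (a , b) , _ = (λ _ _ ((_ , k) , _) _ → ⊥-elim (true≢false g k)) ∷ All-resp-↭ (oddsF-↭ (↭-sym p)) b
                        , All-resp-↭ (evensF-↭ (↭-sym p)) a
    soundE {ps = ps} (kept {v = v} p cs _) r (g ∷ gs) _ with permute p r
    ... | rooted l _ to _ rs with soundCF cs rs gs (v , here refl , g)
    ...   | (a , b) , zs = separated ∷ All-resp-↭ (oddsF-↭ (↭-sym p)) b , All-resp-↭ (evensF-↭ (↭-sym p)) a
      where
      parent : ∀ {u} → Private u v → u ∈ ps
      parent z with ∈-++⁻ ps (to (~-sym (proj₁ (proj₁ z))))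
      ... | inj₁ m = m
      ... | inj₂ m with ∈-map⁻ root m
      ...   | c , c∈ , refl = contradiction z (All.lookup zs c∈ (here refl))
      separated : Separated v
      separated _ _ z z′ = unique-∈ l (parent z) (parent z′)
    soundE {ps = ps} (owned {v = v} {u = u} p c cs _) r (g ∷ gs) q with permute p r
    ... | rooted l _ to _ (s ∷ rs) with soundC c s (++⁻ˡ (asgC c) gs) (v , here refl , g)
                                      | soundCF cs rs (++⁻ʳ (asgC c) gs) (v , here refl , g)
    ...   | (a , b) , _ | (as , bs) , zs =
      separated ∷ All-resp-↭ (oddsF-↭ (↭-sym p)) (++⁺ b bs) , All-resp-↭ (evensF-↭ (↭-sym p)) (++⁺ a as)
      where
      owner : ∀ {x} → Private x v → x ≡ root u
      owner z with ∈-++⁻ ps (to (~-sym (proj₁ (proj₁ z))))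
      ... | inj₁ m = contradiction z (q m)
      ... | inj₂ (here eq) = eq
      ... | inj₂ (there m) with ∈-map⁻ root m
      ...   | c , c∈ , refl = contradiction z (All.lookup zs c∈ (here refl))
      separated : Separated v
      separated _ _ z z′ = trans (owner z) (≡-sym (owner z′))
    soundE (N⇒I e) r g _ = soundE e r g tt
    soundE (R⇒X e) r g q = soundE e r g q
    soundE (I⇒X e) r g q = soundE e r g q

    soundC {ps = ps} (none {v = v} p es _) r g (x , x∈ , x-kept) with permute p r
    ... | rooted _ _ _ from rs with soundEF es rs g (removedEF es g)
    ...   | a , b = ((x , from (∈-++⁺ˡ x∈) , x-kept) ∷ All-resp-↭ (oddsF-↭ (↭-sym p)) b
                    , All-resp-↭ (evensF-↭ (↭-sym p)) a) , tt
    soundC {ps = ps} (some {v = v} {u = u} {us = us} p e es _) r g (x , x∈ , x-kept) with permute p r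
    ... | rooted _ u! _ from (s ∷ rs) = (dominated ∷ All-resp-↭ (oddsF-↭ (↭-sym p)) (++⁺ (proj₂ ae) (proj₂ aes))
                    , All-resp-↭ (evensF-↭ (↭-sym p)) (++⁺ (proj₁ ae) (proj₁ aes))) , not-parent
      where
      u-kept : Kept v (root u)
      u-kept = from (∈-++⁺ʳ ps (here refl)) , keptI e (++⁻ˡ (asgE e) g)
      dominated : Dominated v
      dominated = root u , u-kept
      not-parent : ∀ {y} → y ∈ ps → ¬ Private v y
      not-parent y∈ (_ , only) = Unique-++-≢ u! y∈ (here refl) (≡-sym (only _ u-kept))
      not-child : ∀ {y} → y ∈ map root (u ∷ us) → ¬ Private v y
      not-child y∈ (_ , only) = Unique-++-≢ u! x∈ y∈ (only x (from (∈-++⁺ˡ x∈) , x-kept))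
      ae = soundE e s (++⁻ˡ (asgE e) g) (λ { (here refl) → not-child (here refl) })
      aes = soundEF es rs (++⁻ʳ (asgE e) g) (All.tabulate λ c∈ → λ { (here refl) → not-child (there (∈-map⁺ root c∈)) })
    soundC {ps = ps} (one {v = v} {u = u} {us = us} p e es _) r g q with permute p r
    ... | rooted _ u! _ from (s ∷ rs) = (dominated ∷ All-resp-↭ (oddsF-↭ (↭-sym p)) (++⁺ (proj₂ ae) (proj₂ aes))
                    , All-resp-↭ (evensF-↭ (↭-sym p)) (++⁺ (proj₁ ae) (proj₁ aes))) , tt
      where
      u-kept : Kept v (root u)
      u-kept = from (∈-++⁺ʳ ps (here refl)) , keptI (N⇒I e) (++⁻ˡ (asgE e) g)
      dominated : Dominated v
      dominated = root u , u-kept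
      -- The vertex `v` may be private to `u`, which is why `u` is in state `N`; to no other child
      -- can it be private while `u` survives.
      not-child : ∀ {y} → y ∈ map root us → ¬ Private v y
      not-child y∈ (_ , only) = head-≢ (Unique-++ʳ ps u!) y∈ (only _ u-kept)
      ae = soundE e s (++⁻ˡ (asgE e) g) tt
      aes = soundEF es rs (++⁻ʳ (asgE e) g) (All.tabulate λ c∈ → λ { (here refl) → not-child (∈-map⁺ root c∈) })
    soundC {ps = ps} (two {v = v} {u = u} {u′ = u′} {us = us} p e e′ es _) r g q with permute p r
    ... | rooted _ u! _ from (s ∷ s′ ∷ rs) =
                    (dominated ∷ All-resp-↭ (oddsF-↭ (↭-sym p)) (++⁺ (proj₂ ae) (++⁺ (proj₂ ae′) (proj₂ aes)))
                    , All-resp-↭ (evensF-↭ (↭-sym p)) (++⁺ (proj₁ ae) (++⁺ (proj₁ ae′) (proj₁ aes)))) , tt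
      where
      g₂ = ++⁻ʳ (asgE e) g
      u-kept : Kept v (root u)
      u-kept = from (∈-++⁺ʳ ps (here refl)) , keptI e (++⁻ˡ (asgE e) g)
      u′-kept : Kept v (root u′)
      u′-kept = from (∈-++⁺ʳ ps (there (here refl))) , keptI e′ (++⁻ˡ (asgE e′) g₂)
      dominated : Dominated v
      dominated = root u , u-kept
      not-private : ∀ {y} → ¬ Private v y
      not-private (_ , only) = head-≢ (Unique-++ʳ ps u!) (here refl) (trans (only _ u-kept) (≡-sym (only _ u′-kept)))
      ae = soundE e s (++⁻ˡ (asgE e) g) (λ { (here refl) → not-private })
      ae′ = soundE e′ s′ (++⁻ˡ (asgE e′) g₂) (λ { (here refl) → not-private })
      aes = soundEF es rs (++⁻ʳ (asgE e′) g₂) (All.tabulate λ _ → λ { (here refl) → not-private })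

-- Counting with duplicate-free lists

extract : ∀ {A : Set} {xs ys : List A} → Unique xs → (∀ {x} → x ∈ xs → x ∈ ys) → ∃[ zs ] ys ↭ xs ++ zs
extract {xs = []} {ys} _ _ = ys , ↭-refl
extract {xs = x ∷ xs} (x∉ ∷ u) sub with ∈-∃++ (sub (here refl))
... | as , bs , refl with extract {xs = xs} {as ++ bs} u sub′
  where
  sub′ : ∀ {y} → y ∈ xs → y ∈ as ++ bs
  sub′ m with ∈-resp-↭ (shift x as bs) (sub (there m))
  ... | here refl = contradiction refl (All.lookup x∉ m)
  ... | there m′ = m′
...   | zs , p = zs , ↭-trans (shift x as bs) (prep x p)

count-≤ : ∀ {A : Set} (f : A → Bool) {xs ys : List A} → Unique xs → (∀ {x} → x ∈ xs → x ∈ ys) →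
          (∀ {x} → x ∈ xs → T (f x)) → length xs ≤ sum (map (b2n ∘ f) ys)
count-≤ f {xs} {ys} u sub all with extract u sub
... | zs , p = ≤-trans (count xs all) (≤-trans (ℕ.m≤m+n _ (sum (map (b2n ∘ f) zs))) (≤-reflexive (≡-sym eq)))
  where
  eq : sum (map (b2n ∘ f) ys) ≡ sum (map (b2n ∘ f) xs) + sum (map (b2n ∘ f) zs)
  eq = trans (sum-↭ (map⁺ (b2n ∘ f) p)) (trans (cong sum (map-++ _ xs zs)) (sum-++ (map _ xs) _))
  count : ∀ xs → (∀ {x} → x ∈ xs → T (f x)) → length xs ≤ sum (map (b2n ∘ f) xs)
  count [] _ = z≤n
  count (x ∷ xs) all with f x | all (here refl)
  ... | true | _ = s≤s (count xs (all ∘ there))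

sumFin-tabulate : ∀ {A : Set} n (g : A → ℕ) (h : Fin n → A) → sumFin n (g ∘ h) ≡ sum (map g (tabulate h))
sumFin-tabulate zero g h = refl
sumFin-tabulate (suc n) g h = cong (g (h Fin.zero) +_) (sumFin-tabulate n g (h ∘ Fin.suc))

sumFin-allFin : ∀ n (g : Fin n → ℕ) → sumFin n g ≡ sum (map g (allFin n))
sumFin-allFin n g = sumFin-tabulate n g id

sum-cartesianProduct : ∀ {A B : Set} (g : A × B → ℕ) xs ys →
  sum (map (λ x → sum (map (λ y → g (x , y)) ys)) xs) ≡ sum (map g (cartesianProduct xs ys))
sum-cartesianProduct g [] ys = refl
sum-cartesianProduct g (x ∷ xs) ys =
  trans (cong₂ _+_ (cong sum (map-∘ ys)) (sum-cartesianProduct g xs ys))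
        (trans (≡-sym (sum-++ (map g (map (x ,_) ys)) _)) (cong sum (≡-sym (map-++ g (map (x ,_) ys) _))))

unique-full : ∀ {n} {xs : List (Fin n)} → Unique xs → length xs ≡ n → xs ↭ allFin n
unique-full {n} {xs} u l with extract u (λ {x} _ → ∈-allFin x)
... | [] , p = ↭-sym (subst (allFin n ↭_) (++-identityʳ xs) p)
... | z ∷ zs , p = contradiction len (ℕ.<⇒≢ (≤-trans (s≤s (ℕ.m≤m+n n (length zs))) (≤-reflexive (≡-sym (+-suc n _)))))
  where
  len : n ≡ n + suc (length zs)
  len = trans (≡-sym (length-tabulate id)) (trans (↭-length p) (trans (length-++ xs) (cong (_+ suc (length zs)) l)))

-- Attaching a new leaf to a rooted tree

module _ {V : Set} where

  Edge : List (V × V) → V → V → Set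
  Edge es x y = (x , y) ∈ es ⊎ (y , x) ∈ es

  Edge-sym : ∀ {es x y} → Edge es x y → Edge es y x
  Edge-sym = Sum.swap

  root∈verts : ∀ (t : Tree V) → root t ∈ verts t
  root∈verts (node v ts) = here refl

  roots⊆vertsF : ∀ (ts : List (Tree V)) {x} → x ∈ map root ts → x ∈ vertsF ts
  roots⊆vertsF (t ∷ ts) (here refl) = ∈-++⁺ˡ (root∈verts t)
  roots⊆vertsF (t ∷ ts) (there m) = ∈-++⁺ʳ (verts t) (roots⊆vertsF ts m)

  graft  : V → (t : Tree V) {p : V} → p ∈ verts t → Tree V
  graftF : V → (ts : List (Tree V)) {p : V} → p ∈ vertsF ts → List (Tree V)
  graft y (node x ts) (here _)  = node x (node y [] ∷ ts)
  graft y (node x ts) (there m) = node x (graftF y ts m)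
  graftF y (t ∷ ts) m with ∈-++⁻ (verts t) m
  ... | inj₁ m = graft y t m ∷ ts
  ... | inj₂ m = t ∷ graftF y ts m

  root-graft : ∀ y t {p} (m : p ∈ verts t) → root (graft y t m) ≡ root t
  root-graft y (node x ts) (here _)  = refl
  root-graft y (node x ts) (there m) = refl

  roots-graftF : ∀ y ts {p} (m : p ∈ vertsF ts) → map root (graftF y ts m) ≡ map root ts
  roots-graftF y (t ∷ ts) m with ∈-++⁻ (verts t) m
  ... | inj₁ m = cong (_∷ map root ts) (root-graft y t m)
  ... | inj₂ m = cong (root t ∷_) (roots-graftF y ts m)

  verts-graft  : ∀ y t {p} (m : p ∈ verts t) → verts (graft y t m) ↭ y ∷ verts t
  verts-graftF : ∀ y ts {p} (m : p ∈ vertsF ts) → vertsF (graftF y ts m) ↭ y ∷ vertsF ts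
  verts-graft y (node x ts) (here _)  = swap x y ↭-refl
  verts-graft y (node x ts) (there m) = ↭-trans (prep x (verts-graftF y ts m)) (swap x y ↭-refl)
  verts-graftF y (t ∷ ts) m with ∈-++⁻ (verts t) m
  ... | inj₁ m = ++⁺ʳ (vertsF ts) (verts-graft y t m)
  ... | inj₂ m = ↭-trans (++⁺ˡ (verts t) (verts-graftF y ts m)) (shift y (verts t) (vertsF ts))

  map-rooted  : ∀ {_~_ _≈_ : V → V → Set} {ps t} → (∀ {x y} → x ~ y → x ≈ y) → (∀ {x y} → x ≈ y → x ~ y) →
                Rooted _~_ ps t → Rooted _≈_ ps t
  map-rootedF : ∀ {_~_ _≈_ : V → V → Set} {ps ts} → (∀ {x y} → x ~ y → x ≈ y) → (∀ {x y} → x ≈ y → x ~ y) →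
                All (Rooted _~_ ps) ts → All (Rooted _≈_ ps) ts
  map-rooted f g (rooted l u to from rs) = rooted l u (to ∘ g) (f ∘ from) (map-rootedF f g rs)
  map-rootedF f g [] = []
  map-rootedF f g (r ∷ rs) = map-rooted f g r ∷ map-rootedF f g rs

  module Graft {es : List (V × V)} {p y : V} (p≢y : p ≢ y) (y-new : ∀ {w} → ¬ Edge es y w) where

    es′ : List (V × V)
    es′ = (p , y) ∷ es

    shrink : ∀ {x w} → x ≢ p → x ≢ y → Edge es′ x w → Edge es x w
    shrink x≢p x≢y (inj₁ (here refl)) = contradiction refl x≢p
    shrink x≢p x≢y (inj₂ (here refl)) = contradiction refl x≢y
    shrink x≢p x≢y (inj₁ (there m)) = inj₁ m
    shrink x≢p x≢y (inj₂ (there m)) = inj₂ m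

    grow : ∀ {x w} → Edge es x w → Edge es′ x w
    grow = Sum.map there there

    -- The new edge changes the neighbourhoods of its two ends only, so a branch that contains
    -- neither keeps its description.
    frame  : ∀ {ps} t → p ∉ verts t → y ∉ verts t → Rooted (Edge es) ps t → Rooted (Edge es′) ps t
    frameF : ∀ {ps} ts → p ∉ vertsF ts → y ∉ vertsF ts → All (Rooted (Edge es) ps) ts → All (Rooted (Edge es′) ps) ts
    frame (node x ts) p∉ y∉ (rooted l u to from rs) =
      rooted l u (to ∘ shrink (λ { refl → p∉ (here refl) }) (λ { refl → y∉ (here refl) })) (grow ∘ from)
        (frameF ts (p∉ ∘ there) (y∉ ∘ there) rs)
    frameF [] _ _ [] = []
    frameF (t ∷ ts) p∉ y∉ (r ∷ rs) =
      frame t (p∉ ∘ ∈-++⁺ˡ) (y∉ ∘ ∈-++⁺ˡ) r ∷ frameF ts (p∉ ∘ ∈-++⁺ʳ (verts t)) (y∉ ∘ ∈-++⁺ʳ (verts t)) rs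

    leaf : Rooted (Edge es′) (p ∷ []) (node y [])
    leaf = rooted ≤-refl ([] ∷ []) to (λ { (here refl) → inj₂ (here refl) }) []
      where
      to : ∀ {w} → Edge es′ y w → w ∈ p ∷ []
      to (inj₁ (here refl)) = contradiction refl p≢y
      to (inj₂ (here refl)) = here refl
      to (inj₁ (there m)) = contradiction (inj₁ m) y-new
      to (inj₂ (there m)) = contradiction (inj₂ m) y-new

    rooted-graft  : ∀ {ps} t (m : p ∈ verts t) → Unique (verts t) → y ∉ verts t → y ∉ ps →
                    Rooted (Edge es) ps t → Rooted (Edge es′) ps (graft y t m)
    rooted-graftF : ∀ {ps} ts (m : p ∈ vertsF ts) → Unique (vertsF ts) → y ∉ vertsF ts → y ∉ ps →
                    All (Rooted (Edge es) ps) ts → All (Rooted (Edge es′) ps) (graftF y ts m)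
    rooted-graft {ps} (node x ts) (here refl) u y∉ y∉ps (rooted l u′ to from rs) =
      rooted l (Unique-↭ (↭-sym π) (All.tabulate (λ m eq → y∉′ (subst (_∈ _) (≡-sym eq) m)) ∷ u′))
        to′ from′ (leaf ∷ frameF ts (λ m → head-≢ u m refl) (y∉ ∘ there) rs)
      where
      π : ps ++ y ∷ map root ts ↭ y ∷ ps ++ map root ts
      π = shift y ps (map root ts)
      y∉′ : y ∉ ps ++ map root ts
      y∉′ m with ∈-++⁻ ps m
      ... | inj₁ m = y∉ps m
      ... | inj₂ m = y∉ (there (roots⊆vertsF ts m))
      to′ : ∀ {w} → Edge es′ p w → w ∈ ps ++ y ∷ map root ts
      to′ (inj₁ (here refl)) = ∈-++⁺ʳ ps (here refl)
      to′ (inj₂ (here refl)) = contradiction refl p≢y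
      to′ (inj₁ (there m)) = ∈-resp-↭ (↭-sym π) (there (to (inj₁ m)))
      to′ (inj₂ (there m)) = ∈-resp-↭ (↭-sym π) (there (to (inj₂ m)))
      from′ : ∀ {w} → w ∈ ps ++ y ∷ map root ts → Edge es′ p w
      from′ m with ∈-resp-↭ π m
      ... | here refl = inj₁ (here refl)
      ... | there m = grow (from m)
    rooted-graft {ps} (node x ts) (there m) u@(_ ∷ u₁) y∉ y∉ps (rooted l u′ to from rs)
      = rooted l (subst (λ rs → Unique (ps ++ rs)) (≡-sym eq) u′)
          (subst (λ rs → _ ∈ ps ++ rs) (≡-sym eq) ∘ to ∘ shrink (head-≢ u m) (λ { refl → y∉ (here refl) }))
          (grow ∘ from ∘ subst (λ rs → _ ∈ ps ++ rs) eq)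
          (rooted-graftF ts m u₁ (y∉ ∘ there) (λ { (here refl) → y∉ (here refl) }) rs)
      where
      eq = roots-graftF y ts m
    rooted-graftF (t ∷ ts) m u y∉ y∉ps (r ∷ rs) with ∈-++⁻ (verts t) m
    ... | inj₁ m = rooted-graft t m (Unique-++ˡ u) (y∉ ∘ ∈-++⁺ˡ) y∉ps r
                 ∷ frameF ts (λ m′ → Unique-++-≢ u m m′ refl) (y∉ ∘ ∈-++⁺ʳ (verts t)) rs
    ... | inj₂ m = frame t (λ m′ → Unique-++-≢ u m′ m refl) (y∉ ∘ ∈-++⁺ˡ) r
                 ∷ rooted-graftF ts m (Unique-++ʳ (verts t) u) (y∉ ∘ ∈-++⁺ʳ (verts t)) y∉ps rs

-- From connectedness and the edge count to a tree rooted at a leaf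

module _ {n : ℕ} where

  -- Orients an edge the way `edgeCount` counts it, so that each undirected edge has one
  -- representative.
  norm : Fin n × Fin n → Fin n × Fin n
  norm (x , y) with toℕ x <ᵇ toℕ y
  ... | true  = x , y
  ... | false = y , x

  norm-injective : ∀ {a b c d} → norm (a , b) ≡ norm (c , d) → a ≡ c × b ≡ d ⊎ a ≡ d × b ≡ c
  norm-injective {a} {b} {c} {d} eq with toℕ a <ᵇ toℕ b | toℕ c <ᵇ toℕ d
  norm-injective refl | true  | true  = inj₁ (refl , refl)
  norm-injective refl | true  | false = inj₂ (refl , refl)
  norm-injective refl | false | true  = inj₂ (refl , refl)
  norm-injective refl | false | false = inj₁ (refl , refl)

module Growth {n : ℕ} (G : Graph n) where

  open DecMembership (Fin._≟_ {n}) using (_∈?_)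
  open DecMembership (≡-dec (Fin._≟_ {n}) (Fin._≟_ {n})) using () renaming (_∈?_ to _∈ₑ?_)

  Adj-sym : ∀ {x y} → Adj G x y → Adj G y x
  Adj-sym {x} {y} = subst T (sym G x y)

  Adj-irrefl : ∀ {x} → ¬ Adj G x x
  Adj-irrefl {x} a rewrite irrefl G x = a

  isEdge : Fin n × Fin n → Bool
  isEdge (i , j) = (toℕ i <ᵇ toℕ j) ∧ adj G i j

  norm-isEdge : ∀ {x y} → Adj G x y → T (isEdge (norm (x , y)))
  norm-isEdge {x} {y} a with toℕ x <ᵇ toℕ y in eq
  ... | true rewrite eq = a
  ... | false = Equivalence.from T-∧ (ℕ.<⇒<ᵇ y<x , Adj-sym a)
    where
    y<x : toℕ y < toℕ x
    y<x = ℕ.≤∧≢⇒< (ℕ.≮⇒≥ (λ lt → subst T eq (ℕ.<⇒<ᵇ lt))) λ e → Adj-irrefl (subst (Adj G x) (toℕ-injective e) a)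

  edgeCount-sum : edgeCount G ≡ sum (map (b2n ∘ isEdge) (cartesianProduct (allFin n) (allFin n)))
  edgeCount-sum = trans (sumFin-allFin n _)
    (trans (cong sum (map-cong (λ i → sumFin-allFin n (λ j → b2n (isEdge (i , j)))) (allFin n)))
      (sum-cartesianProduct (b2n ∘ isEdge) (allFin n) (allFin n)))

  -- Each vertex enters with a single edge to an older one, so the newest vertex is a leaf of the
  -- grown tree; the inductions on acyclicity rest on this.
  data Grow (r : Fin n) : List (Fin n) → List (Fin n × Fin n) → Set where
    start  : Grow r (r ∷ []) []
    extend : ∀ {vs es v p} → Grow r vs es → v ∉ vs → p ∈ vs → Adj G p v → Grow r (v ∷ vs) ((p , v) ∷ es)

  module _ {r : Fin n} where

    endpoints : ∀ {vs es x y} → Grow r vs es → Edge es x y → x ∈ vs × y ∈ vs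
    endpoints start (inj₁ ())
    endpoints start (inj₂ ())
    endpoints (extend g v∉ p∈ a) (inj₁ (here refl)) = there p∈ , here refl
    endpoints (extend g v∉ p∈ a) (inj₂ (here refl)) = here refl , there p∈
    endpoints (extend g v∉ p∈ a) (inj₁ (there m)) with endpoints g (inj₁ m)
    ... | x∈ , y∈ = there x∈ , there y∈
    endpoints (extend g v∉ p∈ a) (inj₂ (there m)) with endpoints g (inj₂ m)
    ... | x∈ , y∈ = there x∈ , there y∈

    grow-unique : ∀ {vs es} → Grow r vs es → Unique vs
    grow-unique start = [] ∷ []
    grow-unique (extend g v∉ _ _) = All.tabulate (λ { m refl → v∉ m }) ∷ grow-unique g

    grow-adj : ∀ {vs es x y} → Grow r vs es → (x , y) ∈ es → Adj G x y
    grow-adj (extend g _ _ a) (here refl) = a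
    grow-adj (extend g _ _ a) (there m) = grow-adj g m

    grow-length : ∀ {vs es} → Grow r vs es → suc (length es) ≡ length vs
    grow-length start = refl
    grow-length (extend g _ _ _) = cong suc (grow-length g)

    grow-norm : ∀ {vs es} → Grow r vs es → Unique (map norm es)
    grow-norm start = []
    grow-norm {es = (p , v) ∷ es} (extend g v∉ p∈ a) = All.tabulate fresh ∷ grow-norm g
      where
      fresh : ∀ {e} → e ∈ map norm es → norm (p , v) ≢ e
      fresh m eq with ∈-map⁻ norm m
      ... | (c , d) , m′ , refl with norm-injective eq
      ...   | inj₁ (refl , refl) = v∉ (proj₂ (endpoints g (inj₁ m′)))
      ...   | inj₂ (refl , refl) = v∉ (proj₁ (endpoints g (inj₁ m′)))

    grow-newest : ∀ {vs es v p w} → Grow r vs es → v ∉ vs → p ≢ v → Edge ((p , v) ∷ es) v w → w ≡ p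
    grow-newest g v∉ p≢v (inj₁ (here refl)) = contradiction refl p≢v
    grow-newest g v∉ p≢v (inj₂ (here refl)) = refl
    grow-newest g v∉ p≢v (inj₁ (there m)) = contradiction (proj₁ (endpoints g (inj₁ m))) v∉
    grow-newest g v∉ p≢v (inj₂ (there m)) = contradiction (proj₁ (endpoints g (inj₂ m))) v∉

    -- The newest vertex of a 4-cycle would have two older neighbours.
    no-4-cycle : ∀ {vs es u v w w′} → Grow r vs es → u ≢ v →
                 Edge es u w → Edge es v w → Edge es u w′ → Edge es v w′ → w ≡ w′
    no-4-cycle start _ (inj₁ ()) _ _ _
    no-4-cycle start _ (inj₂ ()) _ _ _
    no-4-cycle {u = u} {v} {w} {w′} (extend {es = es} {v = y} {p = p} g y∉ p∈ a) u≢v uw vw uw′ vw′ =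
      go (u Fin.≟ y) (v Fin.≟ y) (w Fin.≟ y) (w′ Fin.≟ y)
      where
      p≢y : p ≢ y
      p≢y refl = y∉ p∈
      newest : ∀ {x} → Edge ((p , y) ∷ es) y x → x ≡ p
      newest = grow-newest g y∉ p≢y
      older : ∀ {x z} → x ≢ y → z ≢ y → Edge ((p , y) ∷ es) x z → Edge es x z
      older x≢ z≢ (inj₁ (here refl)) = contradiction refl z≢
      older x≢ z≢ (inj₂ (here refl)) = contradiction refl x≢
      older x≢ z≢ (inj₁ (there m)) = inj₁ m
      older x≢ z≢ (inj₂ (there m)) = inj₂ m
      go : Dec (u ≡ y) → Dec (v ≡ y) → Dec (w ≡ y) → Dec (w′ ≡ y) → w ≡ w′
      go (yes refl) _ _ _ = trans (newest uw) (≡-sym (newest uw′))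
      go (no _) (yes refl) _ _ = trans (newest vw) (≡-sym (newest vw′))
      go (no _) (no _) (yes refl) _ =
        contradiction (trans (newest (Edge-sym uw)) (≡-sym (newest (Edge-sym vw)))) u≢v
      go (no _) (no _) (no _) (yes refl) =
        contradiction (trans (newest (Edge-sym uw′)) (≡-sym (newest (Edge-sym vw′)))) u≢v
      go (no u≢) (no v≢) (no w≢) (no w′≢) =
        no-4-cycle g u≢v (older u≢ w≢ uw) (older v≢ w≢ vw) (older u≢ w′≢ uw′) (older v≢ w′≢ vw′)

    -- The grown tree already has `n ∸ 1` edges. One further edge would make `n` different
    -- normalised pairs, more than `edgeCount G` admits.
    all-edges : ∀ {vs es x y} → edgeCount G ≡ n ∸ 1 → Grow r vs es → length vs ≡ n → Adj G x y → Edge es x y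
    all-edges {vs} {es} {x} {y} count g l a with (x , y) ∈ₑ? es | (y , x) ∈ₑ? es
    ... | yes m | _ = inj₁ m
    ... | no _ | yes m = inj₂ m
    ... | no xy∉ | no yx∉ = contradiction n≤n∸1 (ℕ.<⇒≱ (≤-reflexive (trans (cong (λ m → suc (m ∸ 1)) n≡) (≡-sym n≡))))
      where
      n≡ : n ≡ suc (length es)
      n≡ = trans (≡-sym l) (≡-sym (grow-length g))
      fresh : ∀ {e} → e ∈ map norm es → norm (x , y) ≢ e
      fresh m eq with ∈-map⁻ norm m
      ... | (c , d) , m′ , refl with norm-injective eq
      ...   | inj₁ (refl , refl) = xy∉ m′
      ...   | inj₂ (refl , refl) = yx∉ m′
      edges : ∀ {e} → e ∈ norm (x , y) ∷ map norm es → T (isEdge e)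
      edges (here refl) = norm-isEdge a
      edges (there m) with ∈-map⁻ norm m
      ... | (c , d) , m′ , refl = norm-isEdge (grow-adj g m′)
      n≤n∸1 : n ≤ n ∸ 1
      n≤n∸1 = ≤-trans (≤-reflexive (trans n≡ (cong suc (≡-sym (length-map norm es)))))
        (≤-trans (count-≤ isEdge (All.tabulate fresh ∷ grow-norm g)
                   (λ {e} _ → ∈-cartesianProduct⁺ (∈-allFin (proj₁ e)) (∈-allFin (proj₂ e))) edges)
          (≤-reflexive (trans (≡-sym edgeCount-sum) count)))

    grow-tree : ∀ {vs es} → Grow r vs es → ∃[ t ] Rooted (Edge es) [] t × verts t ↭ vs × root t ≡ r
    grow-tree start = node r [] , rooted z≤n [] (λ { (inj₁ ()) ; (inj₂ ()) }) (λ ()) [] , ↭-refl , refl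
    grow-tree (extend {v = v} {p = p} g v∉ p∈ a) with grow-tree g
    ... | t , rt , π , eq = graft v t p∈t ,
          Graft.rooted-graft p≢v (λ e → v∉ (proj₁ (endpoints g e))) t p∈t
            (Unique-↭ (↭-sym π) (grow-unique g)) (v∉ ∘ ∈-resp-↭ π) (λ ()) rt ,
          ↭-trans (verts-graft v t p∈t) (prep v π) , trans (root-graft v t p∈t) eq
      where
      p∈t = ∈-resp-↭ (↭-sym π) p∈
      p≢v : p ≢ v
      p≢v refl = v∉ p∈

    escape : ∀ {vs a b} → Reach G a b → a ∈ vs → b ∉ vs → ∃₂ λ p v → p ∈ vs × v ∉ vs × Adj G p v
    escape here a∈ b∉ = contradiction a∈ b∉
    escape {vs} (step {u} {v} e path) a∈ b∉ with v ∈? vs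
    ... | yes v∈ = escape path v∈ b∉
    ... | no v∉ = u , v , a∈ , v∉ , e

    grow-all : ∀ m {vs es} → Connected G → m + length vs ≡ n → Grow r vs es →
               ∃₂ λ vs es → Grow r vs es × length vs ≡ n
    grow-all zero _ l g = _ , _ , g , l
    grow-all (suc m) {vs} con l g with Fin.any? (λ z → ¬? (z ∈? vs))
    ... | yes (z , z∉) with escape (con r z) (grow-root g) z∉
      where
      grow-root : ∀ {vs es} → Grow r vs es → r ∈ vs
      grow-root start = here refl
      grow-root (extend g _ _ _) = there (grow-root g)
    ...   | p , v , p∈ , v∉ , a = grow-all m con (trans (+-suc m (length vs)) l) (extend g v∉ p∈ a)
    grow-all (suc m) {vs} con l g | no full with extract (allFin⁺ n) (λ {z} _ → decidable-stable (z ∈? vs) (λ z∉ → full (z , z∉)))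
    ... | zs , π = contradiction len (ℕ.<⇒≢ (s≤s (ℕ.m≤n+m (length vs) m)))
      where
      len : length vs ≡ suc m + length vs
      len = ℕ.≤-antisym (ℕ.m≤n+m _ (suc m)) (≤-trans (≤-reflexive l)
        (≤-trans (≤-reflexive (≡-sym (length-tabulate {n = n} id)))
          (≤-trans (ℕ.m≤m+n _ (length zs)) (≤-reflexive (trans (≡-sym (length-++ (allFin n))) (≡-sym (↭-length π)))))))

  -- The form in which acyclicity enters the separation argument: two vertices share at most one
  -- neighbour.
  C₄-free : Set
  C₄-free = ∀ {u v w w′} → u ≢ v → Adj G u w → Adj G v w → Adj G u w′ → Adj G v w′ → w ≡ w′

  spanning : IsTree G → ∀ r → C₄-free × ∃[ t ] Rooted (Adj G) [] t × verts t ↭ allFin n × root t ≡ r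
  spanning (con , count) r with grow-all (n ∸ 1) con (ℕ.m∸n+n≡m (nonempty r)) (start {r})
    where
    nonempty : ∀ {n} → Fin n → 1 ≤ n
    nonempty Fin.zero = s≤s z≤n
    nonempty (Fin.suc _) = s≤s z≤n
  ... | vs , es , g , l with grow-tree g
  ...   | t , rt , π , eq =
    (λ u≢v a b c d → no-4-cycle g u≢v (all a) (all b) (all c) (all d)) ,
    t , map-rooted back all rt , ↭-trans π (unique-full (grow-unique g) l) , eq
    where
    all : ∀ {x y} → Adj G x y → Edge es x y
    all = all-edges count g l
    back : ∀ {x y} → Edge es x y → Adj G x y
    back (inj₁ m) = grow-adj g m
    back (inj₂ m) = Adj-sym (grow-adj g m)

  leafBelow : ∀ {p} t → Rooted (Adj G) (p ∷ []) t → ∃₂ λ x q → Adj G x q × (∀ {w} → Adj G x w → w ≡ q)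
  leafBelow {p} (node v []) (rooted _ _ to from _) = v , p , from (here refl) , λ a → only (to a)
    where
    only : ∀ {w} → w ∈ p ∷ [] → w ≡ p
    only (here eq) = eq
  leafBelow (node v (t ∷ ts)) (rooted _ _ _ _ (r ∷ _)) = leafBelow t r

  -- A tree spanned from an arbitrary vertex serves to find a leaf; a second one is spanned from
  -- that leaf, whose single neighbour becomes the only child.
  rootAtLeaf : IsTree G → 2 ≤ n → C₄-free ×
    ∃₂ λ r t → Rooted (Adj G) [] (node r (t ∷ [])) × verts (node r (t ∷ [])) ↭ allFin n
  rootAtLeaf tree 2≤n@(s≤s _) with spanning tree Fin.zero
  ... | free , node r [] , rooted _ _ to _ _ , π , _ =
        contradiction (trans (↭-length π) (length-tabulate id)) (ℕ.<⇒≢ 2≤n)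
  ... | free , node r (t ∷ ts) , rooted _ _ _ _ (rt ∷ _) , π , _ with leafBelow t rt
  ...   | x , q , xq , only with spanning tree x
  ...     | _ , node _ [] , rooted _ _ to _ _ , _ , refl = contradiction (to xq) λ ()
  ...     | _ , node _ (u ∷ []) , rx , π′ , refl = free , x , u , rx , π′
  ...     | _ , node _ (u ∷ u′ ∷ _) , rooted _ u! _ from _ , _ , refl =
              contradiction (trans (only (from (here refl))) (≡-sym (only (from (there (here refl)))))) (head-≢ u! (here refl))

-- From a pair of derivations to an IO-code

∣tabulate∣ : ∀ n (f : Fin n → Bool) → ∣ Vec.tabulate f ∣ ≡ sumFin n (b2n ∘ f)
∣tabulate∣ zero f = refl
∣tabulate∣ (suc n) f with f Fin.zero | ∣tabulate∣ n (f ∘ Fin.suc)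
... | true  | eq = cong suc eq
... | false | eq = eq

∈-tabulate : ∀ {n} {f : Fin n → Bool} {w} → f w ≡ true → w ∈ₛ Vec.tabulate f
∈-tabulate {f = f} {w} eq = lookup⇒[]= w _ (trans (lookup∘tabulate f w) eq)

key-unique : ∀ {V : Set} {as : Assignment {V}} {v b b′} → Unique (keys as) → (v , b) ∈ as → (v , b′) ∈ as → b ≡ b′
key-unique u (here refl) (here refl) = refl
key-unique u (here refl) (there m) = contradiction refl (head-≢ u (∈-map⁺ proj₁ m))
key-unique u (there m) (here refl) = contradiction refl (head-≢ u (∈-map⁺ proj₁ m))
key-unique (_ ∷ u) (there m) (there m′) = key-unique u m m′

verts-length  : ∀ {V : Set} (t : Tree V) → length (verts t) ≡ size t
vertsF-length : ∀ {V : Set} (ts : List (Tree V)) → length (vertsF ts) ≡ sizeF ts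
verts-length (node v ts) = cong suc (vertsF-length ts)
vertsF-length [] = refl
vertsF-length (t ∷ ts) = trans (length-++ (verts t)) (cong₂ _+_ (verts-length t) (vertsF-length ts))

module Extraction {n : ℕ} (G : Graph n) (free : Growth.C₄-free G) (t : Tree (Fin n))
  (rt : Rooted (Adj G) [] t) (π : verts t ↭ allFin n) where

  open DecMembership (≡-dec (Fin._≟_ {n}) Bool._≟_) using (_∈?_)
  open Growth G using (Adj-sym)

  code : ∀ {e c} → E X t e → C F t c → ∃[ S ] IsIOCode G S × ∣ S ∣ + (e + c) ≤ n
  code {e} {c} dE dC = S , (dominating , separating) , bound
    where
    L : Assignment
    L = asgE dE ++ asgC dC

    keys-L : keys L ↭ allFin n
    keys-L = ↭-trans (↭-reflexive (map-++ proj₁ (asgE dE) (asgC dC)))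
      (↭-trans (++⁺ʳ _ (keysE dE)) (↭-trans (++⁺ˡ (evens t) (keysC dC)) (↭-trans (evens-odds t) π)))

    keys! : Unique (keys L)
    keys! = Unique-↭ (↭-sym keys-L) (allFin⁺ n)

    ρ : Fin n → Bool
    ρ w = does ((w , true) ∈? L)

    ρ-agrees : ∀ {a} → a ∈ L → ρ (proj₁ a) ≡ proj₂ a
    ρ-agrees {v , true} m = dec-true ((v , true) ∈? L) m
    ρ-agrees {v , false} m = dec-false ((v , true) ∈? L) λ m′ → contradiction (key-unique keys! m m′) λ ()

    open Sound (Adj G) Adj-sym ρ

    agrees : Agrees L
    agrees = All.tabulate ρ-agrees

    soundness : (All Separated (evens t) × All Dominated (odds t)) × (All Dominated (evens t) × All Separated (odds t))
    soundness = soundE dE rt (++⁻ˡ (asgE dE) agrees) (λ ()) ,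
                proj₁ (soundC dC rt (++⁻ʳ (asgE dE) agrees) (λ ()))

    everywhere : ∀ {P : Fin n → Set} → All P (evens t) → All P (odds t) → ∀ v → P v
    everywhere ps qs v = All.lookup (++⁺ ps qs)
      (∈-resp-↭ (↭-sym (↭-trans (evens-odds t) π)) (∈-allFin v))

    dominated : ∀ v → Dominated v
    dominated = everywhere (proj₁ (proj₂ soundness)) (proj₂ (proj₁ soundness))

    separated : ∀ v → Separated v
    separated = everywhere (proj₁ (proj₁ soundness)) (proj₂ (proj₂ soundness))

    S : Subset n
    S = Vec.tabulate (not ∘ ρ)

    kept⇒∈ : ∀ {w} → ρ w ≡ false → w ∈ₛ S
    kept⇒∈ eq = ∈-tabulate (cong not eq)

    dominating : ∀ v → ∃[ u ] u ∈ₛ S × Adj G v u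
    dominating v with dominated v
    ... | w , vw , k = w , kept⇒∈ k , vw

    separating : ∀ u v → u ≢ v → ¬ (∀ w → w ∈ₛ S → (Adj G u w → Adj G v w) × (Adj G v w → Adj G u w))
    -- A second surviving neighbour of `u` or of `v` would be common to both and close a 4-cycle. So
    -- `u` and `v` are both private to `w`, against `Separated`.
    separating u v u≢v same with dominated u
    ... | w , uw , k = u≢v (separated w u v
          ((uw , k) , λ w′ (uw′ , k′) → free u≢v uw′ (to k′ uw′) uw vw)
          ((vw , k) , λ w′ (vw′ , k′) → free u≢v (from k′ vw′) vw′ uw vw))
      where
      to : ∀ {w} → ρ w ≡ false → Adj G u w → Adj G v w
      to k = proj₁ (same _ (kept⇒∈ k))
      from : ∀ {w} → ρ w ≡ false → Adj G v w → Adj G u w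
      from k = proj₂ (same _ (kept⇒∈ k))
      vw = to k uw

    bound : ∣ S ∣ + (e + c) ≤ n
    bound = ≤-trans (+-mono-≤ (≤-reflexive size≡)
        (≤-trans (+-mono-≤ (countE dE) (countC dC)) (≤-reflexive (≡-sym (#removed-++ (asgE dE) (asgC dC))))))
      (≤-reflexive (trans (split agrees) (trans (≡-sym (length-map proj₁ L)) (trans (↭-length keys-L) (length-tabulate id)))))
      where
      g : Fin n → ℕ
      g = b2n ∘ not ∘ ρ
      size≡ : ∣ S ∣ ≡ sum (map (g ∘ proj₁) L)
      size≡ = trans (∣tabulate∣ n (not ∘ ρ)) (trans (sumFin-allFin n g)
        (trans (sum-↭ (map⁺ g (↭-sym keys-L))) (cong sum (≡-sym (map-∘ L)))))
      split : ∀ {as} → Agrees as → sum (map (g ∘ proj₁) as) + #removed as ≡ length as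
      split [] = refl
      split {(v , true) ∷ as} (eq ∷ h) rewrite eq = trans (+-suc _ _) (cong suc (split h))
      split {(v , false) ∷ as} (eq ∷ h) rewrite eq = cong suc (split h)

-- The upper bound for trees other than the subdivided star

module _ {n : ℕ} (G : Graph n) (D : ℕ) (3≤D : 3 ≤ D) (maxDeg : MaxDegLe G D) (twinFree : OpenTwinFree G) where

  open Bound {V = Fin n} D (2 * D) ≤-refl (ℕ.*-monoʳ-≤ 2 3≤D)

  degree-bound : ∀ {v xs} → Unique xs → (∀ {w} → w ∈ xs → Adj G v w) → length xs ≤ D
  degree-bound {v} u adjacent = ≤-trans
    (count-≤ (adj G v) u (λ {w} _ → ∈-allFin w) adjacent)
    (≤-trans (≤-reflexive (≡-sym (sumFin-allFin n _))) (maxDeg v))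

  no-twins : ∀ {a b p} → a ≢ b → (∀ {w} → Adj G a w → w ∈ p ∷ []) → Adj G a p →
             (∀ {w} → Adj G b w → w ∈ p ∷ []) → Adj G b p → ⊥
  no-twins {a} {b} {p} a≢b to-a pa to-b pb = twinFree a b a≢b λ w → move (to-a {w}) pb , move (to-b {w}) pa
    where
    move : ∀ {x y w} → (Adj G x w → w ∈ p ∷ []) → Adj G y p → Adj G x w → Adj G y w
    move to yp xw with to xw
    ... | here refl = yp

  rooted⇒good  : ∀ {p t} → Rooted (Adj G) (p ∷ []) t → Good t
  rooted⇒goodF : ∀ {p ts} → All (Rooted (Adj G) (p ∷ [])) ts → All Good ts
  rooted⇒good {p} {node v ts} r@(rooted _ u to from rs) =
    good (subst (λ m → suc m ≤ D) (length-map root ts) (degree-bound u from)) twins (rooted⇒goodF rs)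
    where
    twins : ∀ {a b us} → ¬ (ts ↭ node a [] ∷ node b [] ∷ us)
    twins π with permute π r
    ... | rooted _ (_ ∷ u′) _ _ (rooted _ _ to-a from-a _ ∷ rooted _ _ to-b from-b _ ∷ _) =
      no-twins (head-≢ u′ (here refl)) to-a (from-a (here refl)) to-b (from-b (here refl))
  rooted⇒goodF [] = []
  rooted⇒goodF (r ∷ rs) = rooted⇒good r ∷ rooted⇒goodF rs

  small-code : 5 ≤ n → IsTree G →
    (∀ {r t} → Rooted (Adj G) [] (node r (t ∷ [])) → verts (node r (t ∷ [])) ↭ allFin n → ¬ IsHungStar t) →
    ∃[ S ] IsIOCode G S × 2 * D * ∣ S ∣ ≤ (2 * D ∸ 1) * n
  small-code 5≤n tree noStar with Growth.rootAtLeaf G tree (≤-trans (s≤s (s≤s z≤n)) 5≤n)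
  ... | free , r , t , rt@(rooted _ _ to-r from-r (rt₀ ∷ _)) , π = finish (proj₂ (result (rooted⇒good rt₀)))
    where
    size≡ : suc (size t) ≡ n
    size≡ = trans (cong suc (≡-sym (+-identityʳ (size t))))
      (trans (≡-sym (verts-length (node r (t ∷ [])))) (trans (↭-length π) (length-tabulate id)))

    too-small : ∀ {m} → suc (size t) ≡ m → m < 5 → ⊥
    too-small eq lt = ℕ.<⇒≱ (subst (_< 5) (trans (≡-sym eq) size≡) lt) 5≤n

    Goal = ∃[ S ] IsIOCode G S × 2 * D * ∣ S ∣ ≤ (2 * D ∸ 1) * n

    finish : Exceptional t ⊎ Rootable t → Goal
    finish (inj₁ (inj₁ (v , refl))) = ⊥-elim (too-small refl (s≤s (s≤s (s≤s z≤n))))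
    finish (inj₁ (inj₂ (inj₁ supp))) = ⊥-elim (support rt₀ to-r from-r supp)
      where
      support : ∀ {t} → Rooted (Adj G) (r ∷ []) t → (∀ {w} → Adj G r w → w ∈ root t ∷ []) →
                (∀ {w} → w ∈ root t ∷ [] → Adj G r w) → Support t → ⊥
      support {node v ts} rv to-r from-r (u , us , ρ) with permute ρ rv
      ... | rooted _ u! _ _ (rooted _ _ to-u from-u _ ∷ _) =
        no-twins (head-≢ u! (here refl)) to-r (from-r (here refl)) to-u (from-u (here refl))
    finish (inj₁ (inj₂ (inj₂ (inj₁ (v , _ , refl , _ , _ , refl))))) = ⊥-elim (too-small refl ≤-refl)
    finish (inj₁ (inj₂ (inj₂ (inj₂ star)))) = ⊥-elim (noStar rt π star)
    finish (inj₂ rootable) with rootable r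
    -- The root has no parent, so state `F` applies. Its only neighbour survives in state `N` and
    -- can take `r` as its private vertex.
    ... | e , c , dN , dX , h with Extraction.code G free (node r (t ∷ [])) rt π dX (one ↭-refl dN [] (ℕ.m≤m+n e 0))
    ...   | S , io , bound = S , io , arith
      where
      open ℕ.≤-Reasoning
      W = 2 * D
      arith : W * ∣ S ∣ ≤ (W ∸ 1) * n
      arith = ℕ.+-cancelʳ-≤ n _ _ (begin
        W * ∣ S ∣ + n           ≤⟨ ℕ.+-monoʳ-≤ (W * ∣ S ∣) (subst (_≤ W * (e + c)) size≡ h) ⟩
        W * ∣ S ∣ + W * (e + c) ≡⟨ ≡-sym (ℕ.*-distribˡ-+ W ∣ S ∣ (e + c)) ⟩
        W * (∣ S ∣ + (e + c))   ≡⟨ cong (λ m → W * (∣ S ∣ + m)) (+-comm e c) ⟩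
        W * (∣ S ∣ + (c + e))   ≤⟨ ℕ.*-monoʳ-≤ W bound ⟩
        W * n                   ≡⟨ cong (_* n) (≡-sym (ℕ.m∸n+n≡m 1≤W)) ⟩
        (W ∸ 1 + 1) * n         ≡⟨ ℕ.*-distribʳ-+ n (W ∸ 1) 1 ⟩
        (W ∸ 1) * n + 1 * n     ≡⟨ cong ((W ∸ 1) * n +_) (ℕ.*-identityˡ n) ⟩
        (W ∸ 1) * n + n         ∎)
        where
        1≤W : 1 ≤ W
        1≤W = ≤-trans (s≤s z≤n) (ℕ.*-monoʳ-≤ 2 3≤D)

-- The subdivided star and its IO-codes

data Pos (D : ℕ) : Set where
  centre : Pos D
  mid    : Fin D → Pos D
  leaf   : Fin D → Pos D

data StarAdj {D : ℕ} : Pos D → Pos D → Set where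
  cm : ∀ {i} → StarAdj centre (mid i)
  mc : ∀ {i} → StarAdj (mid i) centre
  ml : ∀ {i} → StarAdj (mid i) (leaf i)
  lm : ∀ {i} → StarAdj (leaf i) (mid i)

number : ∀ {D} → Pos D → ℕ
number centre       = 0
number (mid i)      = suc (toℕ i)
number {D} (leaf i) = suc (toℕ i) + D

toFin : ∀ {D} → Pos D → Fin (1 + D + D)
toFin centre       = Fin.zero
toFin {D} (mid i)  = Fin.suc (i ↑ˡ D)
toFin {D} (leaf i) = Fin.suc (D ↑ʳ i)

fromSplit : ∀ {D} → Fin D ⊎ Fin D → Pos D
fromSplit (inj₁ i) = mid i
fromSplit (inj₂ i) = leaf i

toPos : ∀ D → Fin (1 + D + D) → Pos D
toPos D Fin.zero        = centre
toPos D (Fin.suc k) = fromSplit (splitAt D k)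

toPos-toFin : ∀ {D} (x : Pos D) → toPos D (toFin x) ≡ x
toPos-toFin centre       = refl
toPos-toFin {D} (mid i)  = cong fromSplit (Fin.splitAt-↑ˡ D i D)
toPos-toFin {D} (leaf i) = cong fromSplit (Fin.splitAt-↑ʳ D D i)

toFin-toPos : ∀ D (k : Fin (1 + D + D)) → toFin (toPos D k) ≡ k
toFin-toPos D Fin.zero        = refl
toFin-toPos D (Fin.suc k) = trans (lemma (splitAt D k)) (cong Fin.suc (Fin.join-splitAt D D k))
  where
  lemma : ∀ s → toFin (fromSplit {D} s) ≡ Fin.suc (join D D s)
  lemma (inj₁ i) = refl
  lemma (inj₂ i) = refl

toℕ-toFin : ∀ {D} (x : Pos D) → toℕ (toFin x) ≡ number x
toℕ-toFin centre       = refl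
toℕ-toFin {D} (mid i)  = cong suc (Fin.toℕ-↑ˡ i D)
toℕ-toFin {D} (leaf i) = cong suc (trans (Fin.toℕ-↑ʳ D i) (+-comm D (toℕ i)))

module _ {D : ℕ} where

  number≡0 : ∀ {x : Pos D} → number x ≡ 0 → x ≡ centre
  number≡0 {centre} _ = refl

  inMid⇒≤ : ∀ {a} → T (inMid D a) → 1 ≤ a × a ≤ D
  inMid⇒≤ {a} h with Equivalence.to T-∧ h
  ... | pos , h′ = ℕ.<ᵇ⇒< 0 a pos , Sum.[ (λ lt → ℕ.<⇒≤ (ℕ.<ᵇ⇒< a D lt)) , (λ eq → ≤-reflexive (ℕ.≡ᵇ⇒≡ a D eq)) ] (Equivalence.to (T-∨ {a <ᵇ D}) h′)

  inMid-mid : ∀ (i : Fin D) → T (inMid D (number (mid i)))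
  inMid-mid i with ℕ.m≤n⇒m<n∨m≡n (Fin.toℕ<n i)
  ... | inj₁ lt = Equivalence.from (T-∨ {suc (toℕ i) <ᵇ D}) (inj₁ (ℕ.<⇒<ᵇ lt))
  ... | inj₂ eq = Equivalence.from (T-∨ {suc (toℕ i) <ᵇ D}) (inj₂ (ℕ.≡⇒≡ᵇ _ D eq))

  inMid⇒mid : ∀ {x : Pos D} → T (inMid D (number x)) → ∃[ i ] x ≡ mid i
  inMid⇒mid {mid i} _ = i , refl
  inMid⇒mid {leaf i} h = contradiction (proj₂ (inMid⇒≤ h)) (ℕ.<⇒≱ (s≤s (ℕ.m≤n+m D (toℕ i))))

  number≡leaf : ∀ {x : Pos D} {i} → number x ≡ number (mid i) + D → x ≡ leaf i
  number≡leaf {mid j} {i} eq = contradiction (Fin.toℕ<n j) (ℕ.≤⇒≯ (≤-trans (ℕ.m≤n+m D (toℕ i)) (≤-reflexive (≡-sym (ℕ.suc-injective eq)))))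
  number≡leaf {leaf j} {i} eq = cong leaf (toℕ-injective (ℕ.suc-injective (ℕ.+-cancelʳ-≡ D _ _ eq)))

  edge⇒star : ∀ (x y : Pos D) → T (edgeTS D (number x) (number y)) → StarAdj x y
  edge⇒star x y h with Equivalence.to (T-∨ {(number x ≡ᵇ 0) ∧ inMid D (number y)}) h
  ... | inj₁ h₁ with Equivalence.to T-∧ h₁
  ...   | a , b with number≡0 {x} (ℕ.≡ᵇ⇒≡ (number x) 0 a) | inMid⇒mid {y} b
  ...     | refl | i , refl = cm
  edge⇒star x y h | inj₂ h′ with Equivalence.to (T-∨ {(number y ≡ᵇ 0) ∧ inMid D (number x)}) h′
  ... | inj₁ h₁ with Equivalence.to T-∧ h₁
  ...   | a , b with number≡0 {y} (ℕ.≡ᵇ⇒≡ (number y) 0 a) | inMid⇒mid {x} b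
  ...     | refl | i , refl = mc
  edge⇒star x y h | inj₂ h′ | inj₂ h″ with Equivalence.to (T-∨ {inMid D (number x) ∧ (number y ≡ᵇ (number x + D))}) h″
  ... | inj₁ h₁ with Equivalence.to (T-∧ {inMid D (number x)}) h₁
  ...   | a , b with inMid⇒mid {x} a
  ...     | i , refl with number≡leaf {y} (ℕ.≡ᵇ⇒≡ (number y) _ b)
  ...       | refl = ml
  edge⇒star x y h | inj₂ h′ | inj₂ h″ | inj₂ h₁ with Equivalence.to (T-∧ {inMid D (number y)}) h₁
  ... | a , b with inMid⇒mid {y} a
  ...   | i , refl with number≡leaf {x} (ℕ.≡ᵇ⇒≡ (number x) _ b)
  ...     | refl = lm

  star⇒edge : ∀ {x y : Pos D} → StarAdj x y → T (edgeTS D (number x) (number y))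
  star⇒edge {x} {y} s = Equivalence.from (T-∨ {(number x ≡ᵇ 0) ∧ inMid D (number y)})
    (Sum.map₂ (Equivalence.from (T-∨ {(number y ≡ᵇ 0) ∧ inMid D (number x)}) ∘
      Sum.map₂ (Equivalence.from (T-∨ {inMid D (number x) ∧ (number y ≡ᵇ (number x + D))}))) (choose s))
    where
    choose : ∀ {x y : Pos D} → StarAdj x y → T ((number x ≡ᵇ 0) ∧ inMid D (number y)) ⊎
      T ((number y ≡ᵇ 0) ∧ inMid D (number x)) ⊎ T (inMid D (number x) ∧ (number y ≡ᵇ (number x + D))) ⊎
      T (inMid D (number y) ∧ (number x ≡ᵇ (number y + D)))
    choose (cm {i}) = inj₁ (inMid-mid i)
    choose (mc {i}) = inj₂ (inj₁ (inMid-mid i))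
    choose (ml {i}) = inj₂ (inj₂ (inj₁ (Equivalence.from (T-∧ {inMid D (number (mid i))}) (inMid-mid i , ℕ.≡⇒≡ᵇ (number (leaf i)) _ refl))))
    choose (lm {i}) = inj₂ (inj₂ (inj₂ (Equivalence.from (T-∧ {inMid D (number (mid i))}) (inMid-mid i , ℕ.≡⇒≡ᵇ (number (leaf i)) _ refl))))

T-⇔⇒≡ : ∀ {a b} → (T a → T b) → (T b → T a) → a ≡ b
T-⇔⇒≡ {true} {true} _ _ = refl
T-⇔⇒≡ {true} {false} f _ = ⊥-elim (f tt)
T-⇔⇒≡ {false} {true} _ g = ⊥-elim (g tt)
T-⇔⇒≡ {false} {false} _ _ = refl

module StarCode {n D : ℕ} (G : Graph n) (3≤D : 3 ≤ D) (iso : IsSubdividedStar G D) where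

  open Inverse (proj₁ iso) using (to; from; strictlyInverseˡ; strictlyInverseʳ)

  pos : Fin n → Pos D
  pos u = toPos D (to u)

  at : Pos D → Fin n
  at x = from (toFin x)

  pos-at : ∀ x → pos (at x) ≡ x
  pos-at x = trans (cong (toPos D) (strictlyInverseˡ (toFin x))) (toPos-toFin x)

  at-pos : ∀ u → at (pos u) ≡ u
  at-pos u = trans (cong from (toFin-toPos D (to u))) (strictlyInverseʳ u)

  toℕ-to : ∀ u → toℕ (to u) ≡ number (pos u)
  toℕ-to u = trans (cong toℕ (≡-sym (toFin-toPos D (to u)))) (toℕ-toFin (pos u))

  adj⇒star : ∀ {u v} → Adj G u v → StarAdj (pos u) (pos v)
  adj⇒star {u} {v} a = edge⇒star (pos u) (pos v)
    (subst T (trans (proj₂ iso u v) (cong₂ (edgeTS D) (toℕ-to u) (toℕ-to v))) a)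

  star⇒adj : ∀ {u v} → StarAdj (pos u) (pos v) → Adj G u v
  star⇒adj {u} {v} s =
    subst T (≡-sym (trans (proj₂ iso u v) (cong₂ (edgeTS D) (toℕ-to u) (toℕ-to v)))) (star⇒edge s)

  star⇒adj′ : ∀ {u y} → StarAdj (pos u) y → Adj G u (at y)
  star⇒adj′ {u} {y} s = star⇒adj (subst (StarAdj (pos u)) (≡-sym (pos-at y)) s)

  n≡ : n ≡ 1 + D + D
  n≡ = ↔⇒≡ (proj₁ iso)

  i₀ i₁ : Fin D
  i₀ = Fin.fromℕ< (≤-trans (s≤s z≤n) 3≤D)
  i₁ = Fin.fromℕ< (≤-trans (s≤s (s≤s z≤n)) 3≤D)

  i₀≢i₁ : i₀ ≢ i₁
  i₀≢i₁ eq with trans (≡-sym (Fin.toℕ-fromℕ< _)) (trans (cong toℕ eq) (Fin.toℕ-fromℕ< _))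
  ... | ()

  other : (i : Fin D) → ∃[ j ] j ≢ i
  other i with i₀ Fin.≟ i
  ... | yes refl = i₁ , λ eq → i₀≢i₁ (≡-sym eq)
  ... | no ne = i₀ , ne

  omitted : Fin n
  omitted = at (leaf i₀)

  code : Subset n
  code = ∁ ⁅ omitted ⁆

  ∣∁⁅u⁆∣≡2D : ∀ u → ∣ ∁ ⁅ u ⁆ ∣ ≡ 2 * D
  ∣∁⁅u⁆∣≡2D u = trans (Subset.∣∁p∣≡n∸∣p∣ ⁅ u ⁆)
    (trans (cong₂ _∸_ n≡ (Subset.∣⁅x⁆∣≡1 u)) (cong (D +_) (≡-sym (+-identityʳ D))))

  ∈-code : ∀ {y} → y ≢ leaf i₀ → at y ∈ₛ code
  ∈-code {y} ne = Subset.x∉p⇒x∈∁p λ m → ne (trans (≡-sym (pos-at y))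
    (trans (cong pos (Subset.x∈⁅y⁆⇒x≡y omitted m)) (pos-at (leaf i₀))))

  Distinguished : Pos D → Pos D → Set
  Distinguished x y = ∃[ z ] z ≢ leaf i₀ × StarAdj x z × ¬ StarAdj y z

  distinguish : ∀ x y → x ≢ y → Distinguished x y ⊎ Distinguished y x
  distinguish centre centre ne = contradiction refl ne
  distinguish centre (mid i) _ = inj₁ (mid i , (λ ()) , cm , λ ())
  distinguish centre (leaf i) _ with other i
  ... | j , j≢i = inj₁ (mid j , (λ ()) , cm , λ { lm → j≢i refl })
  distinguish (mid i) centre _ = inj₂ (mid i , (λ ()) , cm , λ ())
  -- Only the leg `i₀` lacks its leaf, so at least one of two subdivision vertices has a leaf in the
  -- code.
  distinguish (mid i) (mid j) ne with i Fin.≟ i₀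
  ... | no i≢i₀ = inj₁ (leaf i , (λ { refl → i≢i₀ refl }) , ml , λ { ml → ne refl })
  ... | yes refl = inj₂ (leaf j , (λ { refl → ne refl }) , ml , λ { ml → ne refl })
  distinguish (mid i) (leaf j) _ = inj₁ (centre , (λ ()) , mc , λ ())
  distinguish (leaf i) centre _ with other i
  ... | j , j≢i = inj₂ (mid j , (λ ()) , cm , λ { lm → j≢i refl })
  distinguish (leaf i) (mid j) _ = inj₂ (centre , (λ ()) , mc , λ ())
  distinguish (leaf i) (leaf j) ne = inj₁ (mid i , (λ ()) , lm , λ { lm → ne refl })

  neighbour : ∀ x → ∃[ y ] y ≢ leaf i₀ × StarAdj x y
  neighbour centre   = mid i₀ , (λ ()) , cm
  neighbour (mid i)  = centre , (λ ()) , mc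
  neighbour (leaf i) = mid i , (λ ()) , lm

  pos-injective : ∀ {u v} → pos u ≡ pos v → u ≡ v
  pos-injective {u} {v} eq = trans (≡-sym (at-pos u)) (trans (cong at eq) (at-pos v))

  isCode : IsIOCode G code
  isCode = dominating , separating
    where
    dominating : ∀ v → ∃[ u ] u ∈ₛ code × Adj G v u
    dominating v with neighbour (pos v)
    ... | y , ne , s = at y , ∈-code ne , star⇒adj′ s

    refuted : ∀ {u v} → Distinguished (pos u) (pos v) → ¬ (∀ w → w ∈ₛ code → Adj G u w → Adj G v w)
    refuted {u} {v} (z , ne , s , ¬s) sub =
      ¬s (subst (StarAdj (pos v)) (pos-at z) (adj⇒star (sub (at z) (∈-code ne) (star⇒adj′ s))))

    separating : ∀ u v → u ≢ v → ¬ (∀ w → w ∈ₛ code → (Adj G u w → Adj G v w) × (Adj G v w → Adj G u w))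
    separating u v u≢v same with distinguish (pos u) (pos v) (u≢v ∘ pos-injective)
    ... | inj₁ d = refuted d λ w m → proj₁ (same w m)
    ... | inj₂ d = refuted d λ w m → proj₂ (same w m)

  module _ (S : Subset n) (io : IsIOCode G S) where

    Missing : Pos D → Set
    Missing x = ∀ w → pos w ≡ x → ¬ w ∈ₛ S

    dominator : ∀ x → ∃[ y ] StarAdj x y × ¬ Missing y
    dominator x with proj₁ io (at x)
    ... | w , w∈ , a = pos w , subst (λ x → StarAdj x (pos w)) (pos-at x) (adj⇒star a) , λ miss → miss w refl w∈

    mid-present : ∀ i → ¬ Missing (mid i)
    mid-present i with dominator (leaf i)
    ... | _ , lm , present = present

    -- Subdivision vertices are the only neighbours of leaves and must be present. Without the
    -- centre and a leaf, the subdivision vertex between them is not dominated; without two leaves,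
    -- their supports both see the centre alone.
    one-missing : ∀ x y → Missing x → Missing y → x ≡ y
    one-missing centre centre _ _ = refl
    one-missing (mid i) _ mx _ = contradiction mx (mid-present i)
    one-missing _ (mid i) _ my = contradiction my (mid-present i)
    one-missing centre (leaf i) mx my with dominator (mid i)
    ... | _ , mc , present = contradiction mx present
    ... | _ , ml , present = contradiction my present
    one-missing (leaf i) centre mx my with dominator (mid i)
    ... | _ , mc , present = contradiction my present
    ... | _ , ml , present = contradiction mx present
    one-missing (leaf i) (leaf j) mx my with i Fin.≟ j
    ... | yes refl = refl
    ... | no i≢j = contradiction (λ w w∈ → only mx my w∈ , only my mx w∈)
          (proj₂ io (at (mid i)) (at (mid j))
            λ eq → i≢j (mid-injective (trans (≡-sym (pos-at (mid i))) (trans (cong pos eq) (pos-at (mid j))))))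
      where
      mid-injective : ∀ {i j : Fin D} → mid i ≡ mid j → i ≡ j
      mid-injective refl = refl
      only : ∀ {i j w} → Missing (leaf i) → Missing (leaf j) → w ∈ₛ S → Adj G (at (mid i)) w → Adj G (at (mid j)) w
      only {i} {j} {w} mi mj w∈ a = star⇒adj (subst (λ x → StarAdj x (pos w)) (≡-sym (pos-at (mid j)))
        (go (pos w) refl (subst (λ x → StarAdj x (pos w)) (pos-at (mid i)) (adj⇒star a))))
        where
        go : ∀ y → pos w ≡ y → StarAdj (mid i) y → StarAdj (mid j) y
        go .centre _ mc = mc
        go .(leaf i) eq ml = contradiction w∈ (mi w eq)

    missing : ∀ {u} → ¬ u ∈ₛ S → Missing (pos u)
    missing u∉ _ eq w∈ = u∉ (subst (_∈ₛ S) (pos-injective eq) w∈)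

    complement-⊆ : ∃[ u ] (∀ {w} → w ∈ₛ ∁ ⁅ u ⁆ → w ∈ₛ S)
    complement-⊆ with Fin.any? (λ u → ¬? (u ∈ₛ? S))
    ... | no full = omitted , λ {w} _ → decidable-stable (w ∈ₛ? S) λ w∉ → full (w , w∉)
    ... | yes (u , u∉) = u , λ {w} w∈ → decidable-stable (w ∈ₛ? S) λ w∉ →
          Subset.x∈∁p⇒x∉p w∈ (subst (_∈ₛ ⁅ u ⁆)
            (≡-sym (pos-injective (one-missing _ _ (missing w∉) (missing u∉)))) (Subset.x∈⁅x⁆ u))

    lower : 2 * D ≤ ∣ S ∣
    lower with complement-⊆
    ... | u , sub = ≤-trans (≤-reflexive (≡-sym (∣∁⁅u⁆∣≡2D u))) (Subset.p⊆q⇒∣p∣≤∣q∣ sub)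

  gamma : ∃[ k ] IsGammaIOC G k × (2 * D + 1) * k ≡ 2 * D * n
  gamma = 2 * D , ((code , isCode , ∣∁⁅u⁆∣≡2D omitted) , lower) , trans (arith D) (cong (2 * D *_) (≡-sym n≡))
    where
    arith : ∀ D → (2 * D + 1) * (2 * D) ≡ 2 * D * (1 + D + D)
    arith = solve-∀

-- The map `g` is injective. If it missed `x`, punching out `x` would inject `Fin (suc m)` into
-- `Fin m`.
surjection⇒inverse : ∀ {m n} → m ≡ n → (f : Fin m → Fin n) (g : Fin n → Fin m) →
                     (∀ y → f (g y) ≡ y) → ∀ x → g (f x) ≡ x
surjection⇒inverse {suc m} refl f g fg x with Fin.any? (λ y → g y Fin.≟ x)
... | yes (y , refl) = cong g (fg y)
... | no missed = contradiction (Fin.injective⇒≤ {f = λ y → punchOut {i = x} {j = g y} λ eq → missed (y , ≡-sym eq)}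
        λ {y} {z} eq → trans (≡-sym (fg y)) (trans (cong f (Fin.punchOut-injective (λ eq₁ → missed (y , ≡-sym eq₁)) (λ eq₁ → missed (z , ≡-sym eq₁)) eq)) (fg z)))
        (ℕ.<⇒≱ ≤-refl)

-- Recognising the subdivided star from a full star hung below two vertices

module Pendant {n : ℕ} (G : Graph n) where

  inner outer : ∀ {ts : List (Tree (Fin n))} → All IsPath₂ ts → Fin (length ts) → Fin n
  inner ((m , l , _) ∷ ps) Fin.zero    = m
  inner (_ ∷ ps)           (Fin.suc i) = inner ps i
  outer ((m , l , _) ∷ ps) Fin.zero    = l
  outer (_ ∷ ps)           (Fin.suc i) = outer ps i

  locate : ∀ {ts} (ps : All IsPath₂ ts) {w} → w ∈ vertsF ts → ∃[ i ] (w ≡ inner ps i ⊎ w ≡ outer ps i)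
  locate ((m , l , refl) ∷ ps) (here refl) = Fin.zero , inj₁ refl
  locate ((m , l , refl) ∷ ps) (there (here refl)) = Fin.zero , inj₂ refl
  locate ((m , l , refl) ∷ ps) (there (there w∈)) with locate ps w∈
  ... | i , d = Fin.suc i , d

  locate-root : ∀ {ts} (ps : All IsPath₂ ts) {w} → w ∈ map root ts → ∃[ i ] w ≡ inner ps i
  locate-root ((m , l , refl) ∷ ps) (here refl) = Fin.zero , refl
  locate-root ((m , l , refl) ∷ ps) (there w∈) with locate-root ps w∈
  ... | i , eq = Fin.suc i , eq

  inner∈roots : ∀ {ts} (ps : All IsPath₂ ts) i → inner ps i ∈ map root ts
  inner∈roots ((m , l , refl) ∷ ps) Fin.zero    = here refl
  inner∈roots (_ ∷ ps)              (Fin.suc i) = there (inner∈roots ps i)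

  rooted-path : ∀ {b ts} (ps : All IsPath₂ ts) → All (Rooted (Adj G) (b ∷ [])) ts → ∀ i →
                Rooted (Adj G) (b ∷ []) (node (inner ps i) (node (outer ps i) [] ∷ []))
  rooted-path ((m , l , refl) ∷ ps) (r ∷ rs) Fin.zero    = r
  rooted-path (_ ∷ ps)              (r ∷ rs) (Fin.suc i) = rooted-path ps rs i

  sizeF-paths : ∀ {ts : List (Tree (Fin n))} → All IsPath₂ ts → sizeF ts ≡ length ts + length ts
  sizeF-paths [] = refl
  sizeF-paths {_ ∷ ts} ((m , l , refl) ∷ ps) = cong suc (trans (cong suc (sizeF-paths ps)) (≡-sym (+-suc (length ts) (length ts))))

  -- The path from the centre `b` through `v` to `r` becomes the leg of index zero. The labelling
  -- `at` reaches every vertex and both sides have the same size, so it is injective by counting,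
  -- without comparing vertices pairwise.
  hungStar⇒subdividedStar : ∀ {D r v b ts} → All IsPath₂ ts → suc (length ts) ≡ D →
    let t = node r (node v (node b ts ∷ []) ∷ []) in
    Rooted (Adj G) [] t → verts t ↭ allFin n → IsSubdividedStar G D
  hungStar⇒subdividedStar {r = r} {v} {b} {ts} ps refl
    (rooted _ _ to-r from-r (rooted _ _ to-v from-v (rooted _ _ to-b from-b rs ∷ []) ∷ [])) π =
    mk↔ₛ′ f g f∘g g∘f , λ x y → T-⇔⇒≡ (to-edge x y) (from-edge x y)
    where
    D = suc (length ts)

    at : Pos D → Fin n
    at centre             = b
    at (mid Fin.zero)     = v
    at (mid (Fin.suc i))  = inner ps i
    at (leaf Fin.zero)    = r
    at (leaf (Fin.suc i)) = outer ps i

    pos′ : ∀ {w} → w ∈ verts (node r (node v (node b ts ∷ []) ∷ [])) → ∃[ x ] at x ≡ w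
    pos′ (here refl) = leaf Fin.zero , refl
    pos′ (there m) with ∈-++⁻ (v ∷ (b ∷ vertsF ts) ++ []) m
    ... | inj₁ (here refl) = mid Fin.zero , refl
    ... | inj₁ (there m) with ∈-++⁻ (b ∷ vertsF ts) m
    ...   | inj₁ (here refl) = centre , refl
    ...   | inj₁ (there m) with locate ps m
    ...     | i , inj₁ eq = mid (Fin.suc i) , ≡-sym eq
    ...     | i , inj₂ eq = leaf (Fin.suc i) , ≡-sym eq

    pos : ∀ w → ∃[ x ] at x ≡ w
    pos w = pos′ (∈-resp-↭ (↭-sym π) (∈-allFin w))

    f : Fin n → Fin (1 + D + D)
    f w = toFin (proj₁ (pos w))

    g : Fin (1 + D + D) → Fin n
    g k = at (toPos D k)

    g∘f : ∀ w → g (f w) ≡ w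
    g∘f w = trans (cong at (toPos-toFin (proj₁ (pos w)))) (proj₂ (pos w))

    n≡ : 1 + D + D ≡ n
    n≡ = trans (trans (arith (length ts)) (cong (λ m → 3 + m + 0 + 0) (≡-sym (sizeF-paths ps))))
      (trans (≡-sym (verts-length (node r (node v (node b ts ∷ []) ∷ [])))) (trans (↭-length π) (length-tabulate id)))
      where
      arith : ∀ m → 1 + suc m + suc m ≡ 3 + (m + m) + 0 + 0
      arith = solve-∀

    f∘g : ∀ k → f (g k) ≡ k
    f∘g = surjection⇒inverse n≡ g f g∘f

    at-injective : ∀ {x y} → at x ≡ at y → x ≡ y
    at-injective {x} {y} eq = trans (back x) (trans (cong (λ w → toPos D (f w)) eq) (≡-sym (back y)))
      where
      back : ∀ x → x ≡ toPos D (f (at x))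
      back x = trans (≡-sym (toPos-toFin x)) (trans (cong (toPos D) (≡-sym (f∘g (toFin x))))
        (cong (λ y → toPos D (f (at y))) (toPos-toFin x)))

    paths : ∀ i → Rooted (Adj G) (b ∷ []) (node (inner ps i) (node (outer ps i) [] ∷ []))
    paths = rooted-path ps rs

    neighbours : ∀ x {w} → Adj G (at x) w → ∃[ y ] w ≡ at y × StarAdj x y
    neighbours centre a with to-b a
    ... | here refl = mid Fin.zero , refl , cm
    ... | there m with locate-root ps m
    ...   | i , eq = mid (Fin.suc i) , eq , cm
    neighbours (mid Fin.zero) a with to-v a
    ... | here refl = leaf Fin.zero , refl , ml
    ... | there (here refl) = centre , refl , mc
    neighbours (leaf Fin.zero) a with to-r a
    ... | here refl = mid Fin.zero , refl , lm
    neighbours (mid (Fin.suc i)) a with paths i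
    ... | rooted _ _ to _ _ with to a
    ...   | here refl = centre , refl , mc
    ...   | there (here refl) = leaf (Fin.suc i) , refl , ml
    neighbours (leaf (Fin.suc i)) a with paths i
    ... | rooted _ _ _ _ (rooted _ _ to _ _ ∷ []) with to a
    ...   | here refl = mid (Fin.suc i) , refl , lm

    adjacent : ∀ {x y} → StarAdj x y → Adj G (at x) (at y)
    adjacent (cm {Fin.zero}) = from-b (here refl)
    adjacent (cm {Fin.suc i}) = from-b (there (inner∈roots ps i))
    adjacent (mc {Fin.zero}) = from-v (there (here refl))
    adjacent (mc {Fin.suc i}) with paths i
    ... | rooted _ _ _ from _ = from (here refl)
    adjacent (ml {Fin.zero}) = from-v (here refl)
    adjacent (ml {Fin.suc i}) with paths i
    ... | rooted _ _ _ from _ = from (there (here refl))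
    adjacent (lm {Fin.zero}) = from-r (here refl)
    adjacent (lm {Fin.suc i}) with paths i
    ... | rooted _ _ _ _ (rooted _ _ _ from _ ∷ []) = from (here refl)

    label : ∀ w → number (proj₁ (pos w)) ≡ toℕ (f w)
    label w = ≡-sym (toℕ-toFin (proj₁ (pos w)))

    to-edge : ∀ x y → T (adj G x y) → T (edgeTS D (toℕ (f x)) (toℕ (f y)))
    to-edge x y a with neighbours (proj₁ (pos x)) (subst (λ x → Adj G x y) (≡-sym (proj₂ (pos x))) a)
    ... | z , eq , s = subst T (cong₂ (edgeTS D) (label x) (label y))
      (star⇒edge {x = proj₁ (pos x)} {proj₁ (pos y)} (subst (StarAdj _) (at-injective (trans (≡-sym eq) (≡-sym (proj₂ (pos y))))) s))

    from-edge : ∀ x y → T (edgeTS D (toℕ (f x)) (toℕ (f y))) → T (adj G x y)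
    from-edge x y e = subst T (cong₂ (adj G) (proj₂ (pos x)) (proj₂ (pos y)))
      (adjacent {proj₁ (pos x)} {proj₁ (pos y)} (edge⇒star (proj₁ (pos x)) (proj₁ (pos y)) (subst T (≡-sym (cong₂ (edgeTS D) (label x) (label y))) e)))

theorem2 : (D : ℕ) → 3 ≤ D → (n : ℕ) → 5 ≤ n → (T : Graph n) →
    IsTree T → OpenTwinFree T → MaxDegLe T D →
    ((¬ IsSubdividedStar T D) →
    ∃ λ S → IsIOCode T S × (2 * D) * ∣ S ∣ ≤ (2 * D ∸ 1) * n) ×
    (IsSubdividedStar T D →
    ∃ λ k → IsGammaIOC T k × (2 * D + 1) * k ≡ (2 * D) * n)
theorem2 D 3≤D n 5≤n T tree twinFree maxDeg =
  (λ notStar → small-code T D 3≤D maxDeg twinFree 5≤n tree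
    λ { {t = node v (node b ts ∷ [])} rt π (_ , _ , refl , ps , eq) →
        notStar (Pendant.hungStar⇒subdividedStar T ps eq rt π) }) ,
  StarCode.gamma T 3≤D
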